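{- Let $H$ be a critical 3-uniform hypergraph. Then $H$ is realizable if and only if $v(H)$ is odd and $H$ is isomorphic to $C_3(T_{v(H)})$, $C_3(U_{v(H)})$ or $C_3(W_{v(H)})$.
   Context: All structures are finite. A 3-uniform hypergraph $H$ consists of a vertex set $V(H)$ and an edge set $E(H)\subseteq\binom{V(H)}{3}$; $v(H)=|V(H)|$. For $v\in V(H)$, $H-v$ is the subhypergraph of $H$ induced by $V(H)\setminus\{v\}$ (its edges are the edges of $H$ not containing $v$). A subset $M$ of $V(H)$ is a module of $H$ if for each $e\in E(H)$ such that $e\cap M\neq\emptyset$ and $e\setminus M\neq\emptyset$, there exists $m\in M$ such that $e\cap M=\{m\}$ and for every $n\in M$, $(e\setminus\{m\})\cup\{n\}\in E(H)$. The sets $\emptyset$, $V(H)$ and $\{v\}$ ($v\in V(H)$) are modules, called trivial. $H$ is decomposable if it has a nontrivial module; $H$ is prime if $v(H)\geq 3$ and all its modules are trivial. $H$ is critical if $H$ is prime and $H-v$ is decomposable for every $v\in V(H)$. A 3-cycle is a tournament on three vertices isomorphic to $(\{0,1,2\},\{01,12,20\})$. The $C_3$-structure $C_3(T)$ of a tournament $T$ is the 3-uniform hypergraph on $V(T)$ whose edges are the 3-element subsets $X$ of $V(T)$ such that $T[X]$ is a 3-cycle. A tournament $T$ with $V(T)=V(H)$ is a realization of $H$ if $H=C_3(T)$; $H$ is realizable if it admits a realization. For $n\geq 1$, let $L_{2n+1}$ be the tournament on $\{0,\ldots,2n\}$ with arcs $pq$ for $0\leq p<q\leq 2n$. The following tournaments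 are defined on $\{0,\ldots,2n\}$: $T_{2n+1}$ is obtained from $L_{2n+1}$ by reversing all the arcs between even and odd vertices; $U_{2n+1}$ is obtained from $L_{2n+1}$ by reversing all the arcs between even vertices; $W_{2n+1}$ is obtained from $L_{2n+1}$ by reversing all the arcs between $2n$ and the even elements of $\{0,\ldots,2n-1\}$. -}

module Defs where

open import Data.Bool.Properties using () renaming (_≟_ to _≟ᵇ_)
open import Data.Fin using (Fin; zero; suc; toℕ; _<_)
open import Data.Fin.Permutation using (Permutation; _⟨$⟩ˡ_)
open import Data.Fin.Properties using (any?; <-cmp)
open import Data.Fin.Subset
open import Data.Nat using (ℕ; suc; pred; _*_; _≤_; _<?_; _≟_)
open import Data.Nat.Divisibility using (_∣_; _∣?_)
open import Data.Product using (Σ; ∃-syntax; _×_; _,_; proj₁)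
open import Data.Sum using (_⊎_; inj₁; inj₂)
open import Data.Vec using ([]; _∷_; insertAt; lookup; tabulate)
open import Data.Vec.Properties using (≡-dec)
open import Function using (_∘_; _⇔_)
open import Level using (0ℓ)
open import Relation.Binary.Core using (Rel)
open import Relation.Binary.Definitions using (Trichotomous; tri<; tri≈; tri>)
open import Relation.Binary.Consequences using (tri⇒dec<)
open import Relation.Binary.PropositionalEquality using (_≡_; refl; sym; cong; trans)
open import Relation.Nullary using (¬_; yes; no)
open import Relation.Nullary.Decidable using (_×-dec_; _⊎-dec_)
open import Relation.Unary using (Pred; Decidable)
open import Relation.Unary.Properties using (∁?; _∩?_)

private variable
  m n : ℕ

-- The vertex set is Fin n.  The edge set is a finite set, which
-- constructively amounts to membership in it being decidable.

record Hypergraph (n : ℕ) : Set₁ where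
  field
    E       : Pred (Subset n) 0ℓ
    E?      : Decidable E
    uniform : ∀ {e} → E e → ∣ e ∣ ≡ 3

open Hypergraph public

∣insertAt-outside∣ : (e : Subset n) (v : Fin (suc n)) →
                     ∣ insertAt e v outside ∣ ≡ ∣ e ∣
∣insertAt-outside∣ e             zero    = refl
∣insertAt-outside∣ (inside  ∷ e) (suc v) = cong suc (∣insertAt-outside∣ e v)
∣insertAt-outside∣ (outside ∷ e) (suc v) = ∣insertAt-outside∣ e v

-- The n vertices other than v are renumbered in increasing order
-- (i : Fin n stands for punchIn v i), so that a set e of them is, as a
-- set of vertices of H, insertAt e v outside.

delete : Hypergraph n → Fin n → Hypergraph (pred n)
delete {suc n} H v = record
  { E       = λ e → E H (insertAt e v outside)
  ; E?      = λ e → E? H (insertAt e v outside)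
  ; uniform = λ {e} p →
      trans (sym (∣insertAt-outside∣ e v)) (uniform H p)
  }

image : Permutation m n → Subset m → Subset n
image π e = tabulate (λ j → lookup e (π ⟨$⟩ˡ j))

infix 4 _≅_ _≐_

_≅_ : Hypergraph m → Hypergraph n → Set
_≅_ {m} {n} H G = Σ (Permutation m n) λ π → ∀ e → E H e ⇔ E G (image π e)

_≐_ : Hypergraph n → Hypergraph n → Set
H ≐ G = ∀ e → E H e ⇔ E G e

IsModule : Hypergraph n → Subset n → Set
IsModule H M = ∀ e → E H e → Nonempty (e ∩ M) → Nonempty (e ─ M) →
  ∃[ m ] m ∈ M × e ∩ M ≡ ⁅ m ⁆ × (∀ n → n ∈ M → E H ((e ─ ⁅ m ⁆) ∪ ⁅ n ⁆))

Trivial : Subset n → Set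
Trivial M = M ≡ ⊥ ⊎ M ≡ ⊤ ⊎ ∃[ v ] M ≡ ⁅ v ⁆

Decomposable : Hypergraph n → Set
Decomposable H = ∃[ M ] IsModule H M × ¬ Trivial M

Prime : Hypergraph n → Set
Prime {n} H = 3 ≤ n × (∀ M → IsModule H M → Trivial M)

Critical : Hypergraph n → Set
Critical H = Prime H × (∀ v → Decomposable (delete H v))

-- Trichotomy: exactly one of x ⟶ y, x ≡ y, y ⟶ x holds.

record Tournament (n : ℕ) : Set₁ where
  field
    _⟶_     : Rel (Fin n) 0ℓ
    compare : Trichotomous _≡_ _⟶_

-- T[X] is isomorphic to ({0,1,2}, {01,12,20}) via 0 ↦ a, 1 ↦ b, 2 ↦ c.

Is3Cycle : Tournament n → Subset n → Set
Is3Cycle T X = ∃[ a ] ∃[ b ] ∃[ c ]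
    X ≡ ⁅ a ⁆ ∪ ⁅ b ⁆ ∪ ⁅ c ⁆ × a ⟶ b × b ⟶ c × c ⟶ a
  where open Tournament T

C₃ : Tournament n → Hypergraph n
C₃ T = record
  { E       = λ X → ∣ X ∣ ≡ 3 × Is3Cycle T X
  ; E?      = λ X → (∣ X ∣ ≟ 3) ×-dec
      any? λ a → any? λ b → any? λ c →
        ≡-dec _≟ᵇ_ X _ ×-dec (a ⟶? b) ×-dec (b ⟶? c) ×-dec (c ⟶? a)
  ; uniform = proj₁
  }
  where
  open Tournament T
  _⟶?_ = tri⇒dec< compare

Realizes : Tournament n → Hypergraph n → Set
Realizes T H = H ≐ C₃ T

Realizable : Hypergraph n → Set₁
Realizable {n} H = Σ (Tournament n) λ T → Realizes T H

-- T with the arcs between a vertex of A and a vertex of B reversed.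
-- A and B may overlap; A = B gives the arcs inside A.

module _ {A B : Pred (Fin n) 0ℓ} (A? : Decidable A) (B? : Decidable B)
         (T : Tournament n) where
  open Tournament T

  Between : Rel (Fin n) 0ℓ
  Between x y = (A x × B y) ⊎ (B x × A y)

  flipped : ∀ {x y} → Between x y → Between y x
  flipped (inj₁ (a , b)) = inj₂ (b , a)
  flipped (inj₂ (b , a)) = inj₁ (a , b)

  _⟶′_ : Rel (Fin n) 0ℓ
  x ⟶′ y = (Between x y × y ⟶ x) ⊎ (¬ Between x y × x ⟶ y)

  yes-case : ∀ {x y} → Between x y → ¬ (y ⟶ x) → ¬ (x ⟶′ y)
  yes-case b ¬yx (inj₁ (_ , yx)) = ¬yx yx
  yes-case b ¬yx (inj₂ (¬b , _)) = ¬b b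

  no-case : ∀ {x y} → ¬ Between x y → ¬ (x ⟶ y) → ¬ (x ⟶′ y)
  no-case ¬b ¬xy (inj₁ (b , _))  = ¬b b
  no-case ¬b ¬xy (inj₂ (_ , xy)) = ¬xy xy

  compare′ : Trichotomous _≡_ _⟶′_
  compare′ x y
    with compare x y | (A? x ×-dec B? y) ⊎-dec (B? x ×-dec A? y)
  ... | tri< xy x≢y ¬yx | yes b = tri> (yes-case b ¬yx) x≢y (inj₁ (flipped b , xy))
  ... | tri< xy x≢y ¬yx | no ¬b = tri< (inj₂ (¬b , xy)) x≢y (no-case (¬b ∘ flipped) ¬yx)
  ... | tri≈ ¬xy x≡y ¬yx | yes b = tri≈ (yes-case b ¬yx) x≡y (yes-case (flipped b) ¬xy)
  ... | tri≈ ¬xy x≡y ¬yx | no ¬b = tri≈ (no-case ¬b ¬xy) x≡y (no-case (¬b ∘ flipped) ¬yx)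
  ... | tri> ¬xy x≢y yx | yes b = tri< (inj₁ (b , yx)) x≢y (yes-case (flipped b) ¬xy)
  ... | tri> ¬xy x≢y yx | no ¬b = tri> (no-case ¬b ¬xy) x≢y (inj₂ (¬b ∘ flipped , yx))

  reverseBetween : Tournament n
  reverseBetween = record { _⟶_ = _⟶′_ ; compare = compare′ }

Even : Pred (Fin m) 0ℓ
Even x = 2 ∣ toℕ x

even? : Decidable (Even {m})
even? x = 2 ∣? toℕ x

L₂ₙ₊₁ T₂ₙ₊₁ U₂ₙ₊₁ W₂ₙ₊₁ : ∀ n → Tournament (suc (2 * n))

L₂ₙ₊₁ n = record { _⟶_ = _<_ ; compare = <-cmp }

T₂ₙ₊₁ n = reverseBetween even? (∁? even?) (L₂ₙ₊₁ n)

U₂ₙ₊₁ n = reverseBetween even? even? (L₂ₙ₊₁ n)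

W₂ₙ₊₁ n = reverseBetween (λ x → toℕ x ≟ 2 * n)
                         (even? ∩? (λ x → toℕ x <? 2 * n))
                         (L₂ₙ₊₁ n)

{-# OPTIONS --safe #-}
module Submission where

-- The tournament inherits criticality from its C₃-structure: a module of a tournament is a
-- module of its 3-cycles, and conversely a nontrivial module M of the 3-cycles either becomes
-- a module of the tournament when the vertices splitting M are added, or the vertices of M
-- dominating everything outside M have a complement which is a module.
--
-- Critical tournaments are classified through Ille's indecomposability graph I, in which
-- x and y are adjacent when deleting both leaves a prime tournament.  By the
-- Ehrenfeucht–Rozenberg growth argument, started from a 3-cycle, I has an edge.  If x and y
-- are adjacent, then deleting x alone leaves a nontrivial module, so either y does not
-- distinguish the remaining vertices, and y is the only neighbour of x, or y has a twin u
-- there, and y and u are the only neighbours of x.  Hence the component of I through an edge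
-- is a path or a cycle, along which arcs depend only on the parities of the two positions.
-- A cycle has odd length, covers all vertices and yields T; a path on an odd number of
-- vertices covers all vertices and yields U; a path on an even number of vertices misses
-- exactly one vertex and yields W.  All arcs may come out reversed, which C₃ does not see.

open import Defs
open import Data.Bool using (Bool; true; false; not; if_then_else_; _xor_; _∨_)
import Data.Bool.Properties as 𝔹
open import Data.Empty using (⊥; ⊥-elim)
open import Data.Fin using (Fin; zero; suc; toℕ; fromℕ<; punchIn; punchOut)
import Data.Fin as Fin
open import Data.Fin.Permutation
  using (Permutation; _⟨$⟩ʳ_; _⟨$⟩ˡ_; inverseˡ; inverseʳ; permutation; ↔⇒≡) renaming (flip to inverse)
open import Data.Fin.Properties
  using (_≟_; any?; all?; injective⇒≤; toℕ-injective; toℕ<n; toℕ-fromℕ<; <-cmp;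
         punchIn-punchOut; punchInᵢ≢i; punchIn-injective)
open import Data.Fin.Subset
  using (Subset; _∈_; _∉_; outside; ⁅_⁆; _∪_; _∩_; _─_; ∣_∣; Nonempty)
import Data.Fin.Subset.Properties as Sub
open import Data.Fin.Subset.Properties using (anySubset?; _∈?_)
open import Data.List using (List; []; _∷_; filter; length; allFin)
import Data.List.Membership.Propositional as L
import Data.List.Membership.Propositional.Properties as L
open import Data.List.Properties using (filter-notAll)
open import Data.List.Relation.Unary.Any as Any using (here; there)
open import Data.Nat using (ℕ; zero; suc; _+_; _*_; _≤_; _<_; z≤n; s≤s)
open import Data.Nat.Divisibility using (_∣_; divides)
open import Data.Nat.Induction using (<-wellFounded)
import Data.Nat.Properties as ℕ
open import Data.Product using (_×_; Σ; ∃-syntax; _,_; proj₁; proj₂)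
open import Data.Sum using (_⊎_; inj₁; inj₂; [_,_])
open import Data.Unit using (⊤; tt)
open import Data.Vec using (tabulate; insertAt; []; _∷_; here; there)
open import Data.Vec.Properties
  using (lookup∘tabulate; []=⇒lookup; lookup⇒[]=; insertAt-lookup; insertAt-punchIn)
open import Function using (_⇔_; _∘_; mk⇔; Equivalence)
open import Induction.WellFounded using (Acc; acc)
open import Level using (0ℓ)
open import Relation.Binary.Consequences using (tri⇒dec<)
open import Relation.Binary.Definitions using (tri<; tri≈; tri>)
open import Relation.Binary.PropositionalEquality hiding ([_])
open import Relation.Nullary using (¬_; Dec; yes; no; does; contradiction)
open import Relation.Nullary.Decidable
  using (¬?; _×-dec_; _⊎-dec_; _→-dec_; decidable-stable; map′; dec-true; dec-false)
open import Relation.Unary using (Pred; Decidable)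
open import Relation.Unary.Properties using (∁?; _∩?_)

-- Decidable predicates as subsets.

module _ {n} {P : Fin n → Set} (P? : Decidable P) where

  subset : Subset n
  subset = tabulate (does ∘ P?)

  ∈-subset⁺ : ∀ {z} → P z → z ∈ subset
  ∈-subset⁺ {z} Pz = lookup⇒[]= z _ (trans (lookup∘tabulate _ z) (dec-true (P? z) Pz))

  ∈-subset⁻ : ∀ {z} → z ∈ subset → P z
  ∈-subset⁻ {z} z∈ with P? z | trans (sym (lookup∘tabulate (does ∘ P?) z)) ([]=⇒lookup z∈)
  ... | yes p | _ = p
  ... | no  _ | ()

-- Modules and prime vertex sets of a tournament.

module Primality {n} (arc : Fin n → Fin n → Bool)
                 (anti : ∀ {x y} → x ≢ y → arc y x ≡ not (arc x y)) where

  V : Set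
  V = Fin n

  VSet : Set₁
  VSet = V → Set

  private variable
    X Y : VSet
    x y u v : V

  flip-arcs : ∀ {a b c d} → a ≢ b → c ≢ d → arc a b ≡ arc c d → arc b a ≡ arc d c
  flip-arcs a≢b c≢d eq = trans (anti a≢b) (trans (cong not eq) (sym (anti c≢d)))

  -- A module M of X is represented by any set with the right trace on X.

  record NontrivialModule (X : VSet) : Set₁ where
    field
      M       : VSet
      M?      : Decidable M
      const   : ∀ {x a b} → X x → ¬ M x → X a → M a → X b → M b → arc x a ≡ arc x b
      {a b c} : V
      Xa      : X a
      Ma      : M a
      Xb      : X b
      Mb      : M b
      Xc      : X c
      ¬Mc     : ¬ M c
      a≢b     : a ≢ b

  open NontrivialModule using () renaming (const to mod-const)

  NontrivialModule-resp : (∀ {z} → Y z → X z) → (∀ {z} → X z → Y z) → NontrivialModule X → NontrivialModule Y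
  NontrivialModule-resp Y⊆X X⊆Y N = record
    { M = M ; M? = M?
    ; const = λ Yx ¬Mx Ya Ma Yb Mb → const (Y⊆X Yx) ¬Mx (Y⊆X Ya) Ma (Y⊆X Yb) Mb
    ; Xa = X⊆Y Xa ; Ma = Ma ; Xb = X⊆Y Xb ; Mb = Mb ; Xc = X⊆Y Xc ; ¬Mc = ¬Mc ; a≢b = a≢b }
    where open NontrivialModule N

  -- `M` ranges over predicates, but only its decidable membership matters, so a search through the
  -- finitely many subsets suffices.
  NontrivialModule? : Decidable X → Dec (NontrivialModule X)
  NontrivialModule? {X} X? = map′ from to (anySubset? λ s → const? s ×-dec nontrivial? s)
    where
    Const′ NonTrivial : Subset n → Set
    Const′ s = ∀ x a b → X x × x ∉ s × X a × a ∈ s × X b × b ∈ s → arc x a ≡ arc x b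
    NonTrivial s = ∃[ a ] ∃[ b ] ∃[ c ]
      (X a × a ∈ s × X b × b ∈ s × X c × c ∉ s × a ≢ b)
    const? : ∀ s → Dec (Const′ s)
    const? s = all? λ x → all? λ a → all? λ b →
      (X? x ×-dec ¬? (x ∈? s) ×-dec X? a ×-dec (a ∈? s) ×-dec X? b ×-dec (b ∈? s))
      →-dec (arc x a 𝔹.≟ arc x b)
    nontrivial? : ∀ s → Dec (NonTrivial s)
    nontrivial? s = any? λ a → any? λ b → any? λ c →
      X? a ×-dec (a ∈? s) ×-dec X? b ×-dec (b ∈? s) ×-dec X? c ×-dec ¬? (c ∈? s) ×-dec ¬? (a ≟ b)
    from : ∃[ s ] (Const′ s × NonTrivial s) → NontrivialModule X
    from (s , k , a , b , c , Xa , as , Xb , bs , Xc , cs , ne) = record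
      { M = _∈ s ; M? = _∈? s
      ; const = λ Xx ¬Mx Xa Ma Xb Mb → k _ _ _ (Xx , ¬Mx , Xa , Ma , Xb , Mb)
      ; Xa = Xa ; Ma = as ; Xb = Xb ; Mb = bs ; Xc = Xc ; ¬Mc = cs ; a≢b = ne }
    to : NontrivialModule X → ∃[ s ] (Const′ s × NonTrivial s)
    to N = s , (λ { x a b (Xx , xs , Xa , as , Xb , bs) →
                    const Xx (xs ∘ ins) Xa (outs as) Xb (outs bs) })
             , a , b , c , Xa , ins Ma , Xb , ins Mb , Xc , ¬Mc ∘ outs , a≢b
      where
      open NontrivialModule N
      s : Subset n
      s = subset M?
      ins : ∀ {z} → M z → z ∈ s
      ins = ∈-subset⁺ M?
      outs : ∀ {z} → z ∈ s → M z
      outs = ∈-subset⁻ M?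

  record Three (X : VSet) : Set where
    constructor three
    field
      {p q r} : V
      Xp : X p
      Xq : X q
      Xr : X r
      p≢q : p ≢ q
      p≢r : p ≢ r
      q≢r : q ≢ r

  other : Three X → ∀ u v → ∃[ w ] (X w × w ≢ u × w ≢ v)
  other (three {p} {q} {r} Xp Xq Xr p≢q p≢r q≢r) u v with p ≟ u | p ≟ v | q ≟ u | q ≟ v
  ... | no pu | no pv | _ | _ = p , Xp , pu , pv
  ... | _ | _ | no qu | no qv = q , Xq , qu , qv
  ... | yes refl | _ | yes refl | _ = contradiction refl p≢q
  ... | _ | yes refl | _ | yes refl = contradiction refl p≢q
  ... | yes refl | _ | _ | yes refl = r , Xr , p≢r ∘ sym , q≢r ∘ sym
  ... | _ | yes refl | yes refl | _ = r , Xr , q≢r ∘ sym , p≢r ∘ sym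

  record PrimeOn (X : VSet) : Set₁ where
    constructor primeOn
    field
      size  : Three X
      ¬ntm  : ¬ NontrivialModule X

  data Trace (X M : VSet) : Set where
    none : (∀ {z} → X z → ¬ M z) → Trace X M
    one  : X v → M v → (∀ {z} → X z → M z → z ≡ v) → Trace X M
    all  : (∀ {z} → X z → M z) → Trace X M

  -- A module of a larger set restricts to a module of `X`, which is trivial when `X` is prime. The
  -- extension lemmas below branch on the three possibilities.
  trace : ∀ {M} → Decidable X → ¬ NontrivialModule X → Decidable M →
          (∀ {x a b} → X x → ¬ M x → X a → M a → X b → M b → arc x a ≡ arc x b) → Trace X M
  trace {X} {M} X? ¬N M? k
    with any? (λ a → X? a ×-dec M? a) | any? (λ c → X? c ×-dec ¬? (M? c))
  ... | no ¬a | _ = none λ Xz Mz → ¬a (_ , Xz , Mz)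
  ... | _ | no ¬c = all λ {z} Xz → decidable-stable (M? z) λ ¬Mz → ¬c (z , Xz , ¬Mz)
  ... | yes (a , Xa , Ma) | yes (c , Xc , ¬Mc) = one Xa Ma λ {z} Xz Mz →
    decidable-stable (z ≟ a) λ z≢a → ¬N record
      { M = M ; M? = M? ; const = k ; Xa = Xz ; Ma = Mz ; Xb = Xa ; Mb = Ma ; Xc = Xc ; ¬Mc = ¬Mc ; a≢b = z≢a }

  infixl 5 _∪′_
  _∪′_ : VSet → V → VSet
  (X ∪′ y) z = X z ⊎ z ≡ y

  ∪′? : Decidable X → ∀ y → Decidable (X ∪′ y)
  ∪′? X? y z = X? z ⊎-dec (z ≟ y)

  -- For `y` outside `X`: the set `X` is a module of `X ∪′ y`.
  Const : VSet → V → Set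
  Const X y = ∀ a b → X a → X b → arc y a ≡ arc y b

  -- For `u` in `X` and `y` outside it: the pair of `y` and `u` is a module of `X ∪′ y`.
  Twin : VSet → V → V → Set
  Twin X y u = ∀ z → X z → z ≢ u → arc z y ≡ arc z u

  Const? : Decidable X → ∀ y → Dec (Const X y)
  Const? X? y = all? λ a → all? λ b → X? a →-dec (X? b →-dec (arc y a 𝔹.≟ arc y b))

  Twin? : Decidable X → ∀ y u → Dec (Twin X y u)
  Twin? X? y u = all? λ z → X? z →-dec (¬? (z ≟ u) →-dec (arc z y 𝔹.≟ arc z u))

  -- Otherwise the vertices of `X` other than `u` form a nontrivial module.
  no-const : PrimeOn X → X u → ¬ (∀ {a b} → X a → a ≢ u → X b → b ≢ u → arc u a ≡ arc u b)
  no-const {X} {u} (primeOn t ¬N) Xu k with other t u u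
  ... | p , Xp , p≢u , _ with other t u p
  ... | q , Xq , q≢u , q≢p = ¬N record
    { M = _≢ u ; M? = λ z → ¬? (z ≟ u)
    ; const = λ {x} Xx ¬Mx Xa a≢u Xb b≢u →
        subst (λ x → arc x _ ≡ arc x _) (sym (decidable-stable (x ≟ u) ¬Mx)) (k Xa a≢u Xb b≢u)
    ; Xa = Xq ; Ma = q≢u ; Xb = Xp ; Mb = p≢u ; Xc = Xu ; ¬Mc = λ f → f refl ; a≢b = q≢p }

  pair-ntm : X u → X v → u ≢ v → (∀ z → X z → z ≢ u → z ≢ v → arc z u ≡ arc z v) →
             ∃[ w ] (X w × w ≢ u × w ≢ v) → NontrivialModule X
  pair-ntm {X} {u} {v} Xu Xv u≢v k (w , Xw , w≢u , w≢v) = record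
    { M = λ z → z ≡ u ⊎ z ≡ v ; M? = λ z → (z ≟ u) ⊎-dec (z ≟ v)
    ; const = λ { Xx ¬Mx _ (inj₁ refl) _ (inj₁ refl) → refl
                ; Xx ¬Mx _ (inj₁ refl) _ (inj₂ refl) → k _ Xx (¬Mx ∘ inj₁) (¬Mx ∘ inj₂)
                ; Xx ¬Mx _ (inj₂ refl) _ (inj₁ refl) → sym (k _ Xx (¬Mx ∘ inj₁) (¬Mx ∘ inj₂))
                ; Xx ¬Mx _ (inj₂ refl) _ (inj₂ refl) → refl }
    ; Xa = Xu ; Ma = inj₁ refl ; Xb = Xv ; Mb = inj₂ refl
    ; Xc = Xw ; ¬Mc = [ w≢u , w≢v ] ; a≢b = u≢v }

  twins-equal : PrimeOn X → X u → X v → (∀ z → X z → z ≢ u → z ≢ v → arc z u ≡ arc z v) → u ≡ v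
  twins-equal {X} {u} {v} (primeOn t ¬N) Xu Xv k = decidable-stable (u ≟ v) λ u≢v →
    ¬N (pair-ntm Xu Xv u≢v k (other t u v))

  ∉-≢ : X u → ¬ X x → u ≢ x
  ∉-≢ Xu ¬Xx refl = ¬Xx Xu

  -- The trace of the module on `X` cannot be empty, as `y` alone is too small. If it is all of `X`,
  -- then `y` lies outside the module and is constant on `X`; if it is one vertex, then `y` is the
  -- second element and a twin of that vertex.
  extend1 : Decidable X → PrimeOn X → ¬ X y → NontrivialModule (X ∪′ y) →
            Const X y ⊎ ∃[ u ] (X u × Twin X y u)
  extend1 {X} {y} X? (primeOn t ¬N) ¬Xy N
    with trace X? ¬N (NontrivialModule.M? N) (λ Xx ¬Mx Xa Ma Xb Mb → mod-const N (inj₁ Xx) ¬Mx (inj₁ Xa) Ma (inj₁ Xb) Mb)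
  extend1 {X} {y} X? (primeOn t ¬N) ¬Xy N | tr = go tr
    where
    open NontrivialModule N
    go : Trace X M → _
    go (none k) with Xa | Xb
    ... | inj₁ Xa | _ = contradiction Ma (k Xa)
    ... | _ | inj₁ Xb = contradiction Mb (k Xb)
    ... | inj₂ refl | inj₂ refl = contradiction refl a≢b
    go (all k) with Xc
    ... | inj₁ Xc = contradiction (k Xc) ¬Mc
    ... | inj₂ refl = inj₁ λ a b Xa Xb → const (inj₂ refl) ¬Mc (inj₁ Xa) (k Xa) (inj₁ Xb) (k Xb)
    go (one {v} Xv Mv k) = inj₂ (v , Xv , λ z Xz z≢v →
      const (inj₁ Xz) (z≢v ∘ k Xz) (inj₂ refl) (My Xa Xb) (inj₁ Xv) Mv)
      where
      My : (X ∪′ y) a → (X ∪′ y) b → M y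
      My (inj₂ refl) _ = Ma
      My _ (inj₂ refl) = Mb
      My (inj₁ Xa) (inj₁ Xb) = contradiction (trans (k Xa Ma) (sym (k Xb Mb))) a≢b

  module _ (X? : Decidable X) (P : PrimeOn X) (¬Xx : ¬ X x) (¬Xy : ¬ X y) (x≢y : x ≢ y)
           (N : NontrivialModule (X ∪′ x ∪′ y)) where
    open NontrivialModule N
    private
      in-x : (X ∪′ x ∪′ y) x
      in-x = inj₁ (inj₂ refl)
      in-y : (X ∪′ x ∪′ y) y
      in-y = inj₂ refl
      in-X : ∀ {z} → X z → (X ∪′ x ∪′ y) z
      in-X = inj₁ ∘ inj₁

      tr : Trace X M
      tr = trace X? (PrimeOn.¬ntm P) M? λ Xx ¬Mx Xa Ma Xb Mb →
        const (in-X Xx) ¬Mx (in-X Xa) Ma (in-X Xb) Mb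

      missed : (∀ {z} → X z → M z) → ¬ M x ⊎ ¬ M y
      missed k with Xc
      ... | inj₁ (inj₁ Xc) = contradiction (k Xc) ¬Mc
      ... | inj₁ (inj₂ refl) = inj₁ ¬Mc
      ... | inj₂ refl = inj₂ ¬Mc

      met : (∀ {z w} → X z → M z → X w → M w → z ≡ w) → M x ⊎ M y
      met k with Xa | Xb
      ... | inj₁ (inj₁ Xa) | inj₁ (inj₁ Xb) = contradiction (k Xa Ma Xb Mb) a≢b
      ... | inj₁ (inj₂ refl) | _ = inj₁ Ma
      ... | inj₂ refl | _ = inj₂ Ma
      ... | _ | inj₁ (inj₂ refl) = inj₁ Mb
      ... | _ | inj₂ refl = inj₂ Mb

      met-both : (∀ {z} → X z → ¬ M z) → M x × M y
      met-both k with Xa | Xb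
      ... | inj₁ (inj₁ Xa) | _ = contradiction Ma (k Xa)
      ... | _ | inj₁ (inj₁ Xb) = contradiction Mb (k Xb)
      ... | inj₁ (inj₂ refl) | inj₁ (inj₂ refl) = contradiction refl a≢b
      ... | inj₁ (inj₂ refl) | inj₂ refl = Ma , Mb
      ... | inj₂ refl | inj₁ (inj₂ refl) = Mb , Ma
      ... | inj₂ refl | inj₂ refl = contradiction refl a≢b

    -- In the intended case the module contains `x` and `u` but not `y`. The other traces make `y` a
    -- twin of `u`, contradict the primality of `X`, or force the equality through a chain of arcs.
    extend2-twin : X u → Twin X x u → ¬ Twin X y u → arc y x ≡ arc y u
    extend2-twin {u} Xu tw ¬tw with tr
    ... | none k with met-both k
    ...   | Mx , My = contradiction (λ z Xz z≢u →
              trans (const (in-X Xz) (k Xz) in-y My in-x Mx) (tw z Xz z≢u)) ¬tw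
    extend2-twin {u} Xu tw ¬tw | all k with M? x | missed k
    ... | yes Mx | inj₁ ¬Mx = contradiction Mx ¬Mx
    ... | yes Mx | inj₂ ¬My = const in-y ¬My in-x Mx (in-X Xu) (k Xu)
    -- The module contains `X` but not `x`, so `x` is constant on `X`; its twin `u` is then constant
    -- on the rest of `X`.
    ... | no ¬Mx | _ = contradiction
      (λ {a} {b} Xa a≢u Xb b≢u → trans
          (flip-arcs a≢u (∉-≢ Xa ¬Xx) (sym (tw a Xa a≢u)))
          (trans (const in-x ¬Mx (in-X Xa) (k Xa) (in-X Xb) (k Xb))
                 (flip-arcs (∉-≢ Xb ¬Xx) b≢u (tw b Xb b≢u))))
      (no-const P Xu)
    extend2-twin {u} Xu tw ¬tw | one {v} Xv Mv k with M? x | M? y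
    -- Both `u` and `v` are twins of `x`, hence they coincide.
    ... | yes Mx | _ = go (twins-equal P Xu Xv λ z Xz z≢u z≢v →
            trans (sym (tw z Xz z≢u)) (const (in-X Xz) (z≢v ∘ k Xz) in-x Mx (in-X Xv) Mv))
      where
      go : u ≡ v → arc y x ≡ arc y u
      go refl with M? y
      ... | no ¬My = const in-y ¬My in-x Mx (in-X Xu) Mv
      ... | yes My = contradiction
        (λ z Xz z≢u → const (in-X Xz) (z≢u ∘ k Xz) in-y My (in-X Xu) Mv) ¬tw
    ... | no ¬Mx | no ¬My =
      contradiction (met (λ Xz Mz Xw Mw → trans (k Xz Mz) (sym (k Xw Mw)))) [ ¬Mx , ¬My ]
    -- The module is the pair of `v` and `y`, with `v` different from `u`: the arcs `x y`, `x v`,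
    -- `u v`, `u y` agree in turn, by the module, the twins `x` and `u`, and the module again.
    ... | no ¬Mx | yes My = flip-arcs x≢y (∉-≢ Xu ¬Xy)
      (trans (const in-x ¬Mx in-y My (in-X Xv) Mv)
      (trans (flip-arcs (∉-≢ Xv ¬Xx) v≢u (tw v Xv v≢u))
             (sym (tw-y u Xu (v≢u ∘ sym)))))
      where
      tw-y : Twin X y v
      tw-y z Xz z≢v = const (in-X Xz) (z≢v ∘ k Xz) in-y My (in-X Xv) Mv
      v≢u : v ≢ u
      v≢u refl = ¬tw tw-y

    -- Either the module contains `y` and a vertex of `X` but not `x`, which gives the equality, or
    -- constancy passes from `x` to `y` or to a vertex of `X`, which is excluded.
    extend2-const : Const X x → ¬ Const X y → ∀ {p} → X p → arc x y ≡ arc x p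
    extend2-const cx ¬cy {p} Xp with tr
    ... | none k with met-both k
    ...   | Mx , My = contradiction (λ a b Xa Xb →
              trans (flip-arcs (∉-≢ Xa ¬Xy) (∉-≢ Xa ¬Xx) (const (in-X Xa) (k Xa) in-y My in-x Mx))
              (trans (cx a b Xa Xb)
                (flip-arcs (∉-≢ Xb ¬Xx) (∉-≢ Xb ¬Xy) (const (in-X Xb) (k Xb) in-x Mx in-y My)))) ¬cy
    extend2-const cx ¬cy {p} Xp | all k with M? y
    ... | no ¬My = contradiction
            (λ a b Xa Xb → const in-y ¬My (in-X Xa) (k Xa) (in-X Xb) (k Xb)) ¬cy
    ... | yes My with missed k
    ...   | inj₁ ¬Mx = const in-x ¬Mx in-y My (in-X Xp) (k Xp)
    ...   | inj₂ ¬My = contradiction My ¬My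
    extend2-const cx ¬cy {p} Xp | one {v} Xv Mv k with M? x | M? y
    -- The pair of `v` and `x` would lie in a module meeting `X` only in `v`, so `v` would be
    -- constant on the rest of `X`.
    ... | yes Mx | _ = contradiction
      (λ {a} {b} Xa a≢v Xb b≢v → trans
         (flip-arcs a≢v (∉-≢ Xa ¬Xx) (const (in-X Xa) (a≢v ∘ k Xa) (in-X Xv) Mv in-x Mx))
         (trans (cx a b Xa Xb)
         (flip-arcs (∉-≢ Xb ¬Xx) b≢v (const (in-X Xb) (b≢v ∘ k Xb) in-x Mx (in-X Xv) Mv))))
      (no-const P Xv)
    ... | no ¬Mx | no ¬My =
      contradiction (met (λ Xz Mz Xw Mw → trans (k Xz Mz) (sym (k Xw Mw)))) [ ¬Mx , ¬My ]
    ... | no ¬Mx | yes My = trans (const in-x ¬Mx in-y My (in-X Xv) Mv) (cx v p Xv Xp)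

-- Growing a prime vertex set by one or two vertices.

module Growth {n} (arc : Fin n → Fin n → Bool)
              (anti : ∀ {x y} → x ≢ y → arc y x ≡ not (arc x y)) where
  open Primality arc anti

  private variable
    X Y : VSet
    x y u v : V

  Full : VSet
  Full _ = ⊤

  Off : V → VSet
  Off x z = z ≢ x

  Off₂ : V → V → VSet
  Off₂ x y z = z ≢ x × z ≢ y

  Off? : ∀ x → Decidable (Off x)
  Off? x z = ¬? (z ≟ x)

  Off₂? : ∀ x y → Decidable (Off₂ x y)
  Off₂? x y z = ¬? (z ≟ x) ×-dec ¬? (z ≟ y)

  Three-mono : (∀ {z} → X z → Y z) → Three X → Three Y
  Three-mono i (three Xp Xq Xr a b c) = three (i Xp) (i Xq) (i Xr) a b c

  NontrivialModule-size : NontrivialModule X → Three X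
  NontrivialModule-size N = three Xa Xb Xc a≢b (λ { refl → ¬Mc Ma }) (λ { refl → ¬Mc Mb })
    where open NontrivialModule N

  PrimeOn-resp : (∀ {z} → X z → Y z) → (∀ {z} → Y z → X z) → PrimeOn X → PrimeOn Y
  PrimeOn-resp X⊆Y Y⊆X (primeOn t ¬N) = primeOn (Three-mono X⊆Y t) (¬N ∘ NontrivialModule-resp X⊆Y Y⊆X)

  -- If no one- or two-vertex extension of X is prime, then either u together with its
  -- twins outside X, or the complement of the outside vertices constant on X, is a module.

  step : ¬ NontrivialModule Full → Decidable X → PrimeOn X → ∀ {z} → ¬ X z →
         (∃[ x ] (¬ X x × PrimeOn (X ∪′ x))) ⊎
         (∃[ x ] ∃[ y ] (¬ X x × ¬ X y × x ≢ y × PrimeOn (X ∪′ x ∪′ y)))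
  step {X} ¬NF X? P@(primeOn t ¬N) {z} ¬Xz
    with any? (λ x → ¬? (X? x) ×-dec ¬? (NontrivialModule? (∪′? X? x)))
       | any? (λ x → any? λ y → ¬? (X? x) ×-dec ¬? (X? y) ×-dec ¬? (x ≟ y) ×-dec
                     ¬? (NontrivialModule? (∪′? (∪′? X? x) y)))
  ... | yes (x , ¬Xx , ¬Nx) | _ = inj₁ (x , ¬Xx , primeOn (Three-mono inj₁ t) ¬Nx)
  ... | no _ | yes (x , y , ¬Xx , ¬Xy , x≢y , ¬Nxy) =
    inj₂ (x , y , ¬Xx , ¬Xy , x≢y , primeOn (Three-mono (inj₁ ∘ inj₁) t) ¬Nxy)
  ... | no ¬1 | no ¬2 = contradiction (bad (extend1 X? P ¬Xz (N₁ ¬Xz))) ¬NF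
    where
    N₁ : ∀ {x} → ¬ X x → NontrivialModule (X ∪′ x)
    N₁ {x} ¬Xx = decidable-stable (NontrivialModule? (∪′? X? x)) λ ¬Nx → ¬1 (x , ¬Xx , ¬Nx)
    N₂ : ∀ {x y} → ¬ X x → ¬ X y → x ≢ y → NontrivialModule (X ∪′ x ∪′ y)
    N₂ {x} {y} ¬Xx ¬Xy x≢y = decidable-stable (NontrivialModule? (∪′? (∪′? X? x) y))
      λ ¬Nxy → ¬2 (x , y , ¬Xx , ¬Xy , x≢y , ¬Nxy)
    bad : Const X z ⊎ ∃[ u ] (X u × Twin X z u) → NontrivialModule Full
    bad (inj₁ cz) = record
      { M = M ; M? = M? ; const = λ {x} _ ¬Mx _ Ma _ Mb → trans (eq ¬Mx Ma) (sym (eq ¬Mx Mb))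
      ; Xa = tt ; Ma = inj₁ Xp ; Xb = tt ; Mb = inj₁ Xq ; Xc = tt ; ¬Mc = [ ¬Xz , (λ f → f cz) ]
      ; a≢b = p≢q }
      where
      open Three t
      M : VSet
      M w = X w ⊎ ¬ Const X w
      M? : Decidable M
      M? w = X? w ⊎-dec ¬? (Const? X? w)
      eq : ∀ {x a} → ¬ M x → M a → arc x a ≡ arc x p
      eq {x} {a} ¬Mx Ma with X? a | Ma
      ... | yes Xa | _ = decidable-stable (Const? X? x) (¬Mx ∘ inj₂) a p Xa Xp
      ... | no ¬Xa | inj₁ Xa = contradiction Xa ¬Xa
      ... | no ¬Xa | inj₂ ¬ca = extend2-const X? P ¬Xx ¬Xa (λ { refl → ¬ca cx }) (N₂ ¬Xx ¬Xa λ { refl → ¬ca cx }) cx ¬ca Xp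
        where
        cx : Const X x
        cx = decidable-stable (Const? X? x) (¬Mx ∘ inj₂)
        ¬Xx : ¬ X x
        ¬Xx = ¬Mx ∘ inj₁
    bad (inj₂ (u , Xu , tz)) with other t u u
    ... | w , Xw , w≢u , _ = record
      { M = M ; M? = M? ; const = λ {x} _ ¬Mx _ Ma _ Mb → trans (eq ¬Mx Ma) (sym (eq ¬Mx Mb))
      ; Xa = tt ; Ma = inj₁ refl ; Xb = tt ; Mb = inj₂ (¬Xz , tz)
      ; Xc = tt ; ¬Mc = [ w≢u , (λ (¬Xw , _) → ¬Xw Xw) ] ; a≢b = ∉-≢ Xu ¬Xz }
      where
      M : VSet
      M w = w ≡ u ⊎ (¬ X w × Twin X w u)
      M? : Decidable M
      M? w = (w ≟ u) ⊎-dec (¬? (X? w) ×-dec Twin? X? w u)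
      eq : ∀ {x a} → ¬ M x → M a → arc x a ≡ arc x u
      eq ¬Mx (inj₁ refl) = refl
      eq {x} {a} ¬Mx (inj₂ (¬Xa , ta)) with X? x
      ... | yes Xx = ta x Xx (¬Mx ∘ inj₁)
      ... | no ¬Xx = extend2-twin X? P ¬Xa ¬Xx a≢x (N₂ ¬Xa ¬Xx a≢x) Xu ta λ tx → ¬Mx (inj₂ (¬Xx , tx))
        where
        a≢x : a ≢ x
        a≢x refl = ¬Mx (inj₂ (¬Xa , ta))

  -- The list need only contain the vertices outside `X`; surplus entries do no harm. Its length is
  -- the termination measure of `grow`.
  Cover : VSet → List V → Set
  Cover X l = ∀ z → X z ⊎ z L.∈ l

  cover-extend : ∀ {l} → Cover X l → (∀ {z} → X z → Y z) → Y x → Cover Y (filter (Off? x) l)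
  cover-extend {x = x} cover X⊆Y Yx z with cover z | z ≟ x
  ... | inj₁ Xz | _ = inj₁ (X⊆Y Xz)
  ... | _ | yes refl = inj₁ Yx
  ... | inj₂ z∈l | no z≢x = inj₂ (L.∈-filter⁺ (Off? x) z∈l z≢x)

  cover-shrinks : ∀ {l} → Cover X l → ¬ X x → length (filter (Off? x) l) < length l
  cover-shrinks {X} {x} {l} cover ¬Xx with cover x
  ... | inj₁ Xx = contradiction Xx ¬Xx
  ... | inj₂ x∈l = filter-notAll (Off? x) l (Any.map (λ eq w≢x → w≢x (sym eq)) x∈l)

  -- Prime sets are enlarged until one more step would exhaust the vertices. That last step adds two
  -- vertices, because criticality forbids a prime set missing exactly one.
  grow : ¬ NontrivialModule Full → (∀ x → NontrivialModule (Off x)) → Decidable X → PrimeOn X → ∀ {z} → ¬ X z →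
         ∃[ x ] ∃[ y ] (x ≢ y × PrimeOn (Off₂ x y))
  grow {X} ¬NF crit X? P {z} ¬Xz = go X? P ¬Xz (allFin n) (λ _ → inj₂ (L.∈-allFin _)) (<-wellFounded _)
    where
    go : ∀ {X : VSet} → Decidable X → PrimeOn X → ∀ {z} → ¬ X z →
         (l : List V) → Cover X l → Acc _<_ (length l) →
         ∃[ x ] ∃[ y ] (x ≢ y × PrimeOn (Off₂ x y))
    go {X} X? P ¬Xz l cover (acc rec) with step ¬NF X? P ¬Xz
    ... | inj₁ (x , ¬Xx , Px) with any? (λ w → ¬? (∪′? X? x w))
    ...   | yes (w , ¬w) = go (∪′? X? x) Px ¬w _
              (cover-extend cover inj₁ (inj₂ refl)) (rec (cover-shrinks cover ¬Xx))
    ...   | no full = contradiction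
              (NontrivialModule-resp (λ {w} Xw → ∉-≢ Xw ¬Xx) back (crit x)) (PrimeOn.¬ntm P)
      where
      back : ∀ {w} → Off x w → X w
      back {w} w≢x = decidable-stable (X? w) λ ¬Xw → full (w , [ ¬Xw , w≢x ])
    go {X} X? P ¬Xz l cover (acc rec) | inj₂ (x , y , ¬Xx , ¬Xy , x≢y , Pxy)
      with any? (λ w → ¬? (∪′? (∪′? X? x) y w))
    -- Two vertices were added, but removing `x` alone already shortens the list.
    ...   | yes (w , ¬w) = go (∪′? (∪′? X? x) y) Pxy ¬w _
              (cover-extend cover (inj₁ ∘ inj₁) (inj₁ (inj₂ refl))) (rec (cover-shrinks cover ¬Xx))
    ...   | no full = x , y , x≢y , PrimeOn-resp (λ Xw → ∉-≢ Xw ¬Xx , ∉-≢ Xw ¬Xy) back P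
      where
      back : ∀ {w} → Off₂ x y w → X w
      back {w} (w≢x , w≢y) = decidable-stable (X? w) λ ¬Xw → full (w , [ [ ¬Xw , w≢x ] , w≢y ])

-- From modules of the cyclic triples to modules of the tournament.

module CyclicTriples {n} (arc : Fin n → Fin n → Bool)
                     (anti : ∀ {x y} → x ≢ y → arc y x ≡ not (arc x y)) where
  open Primality arc anti

  -- Equality of the three arcs covers both orientations of the 3-cycle.

  Cyc : V → V → V → Set
  Cyc a b c = arc a b ≡ arc b c × arc b c ≡ arc c a

  module _ {A : Set} {P : A → Set} (P? : Decidable P) (R : A → A → Set)
           (total : ∀ {x y} → P x → P y → R x y ⊎ R y x)
           (transitive : ∀ {x y z} → P x → P y → P z → R x y → R y z → R x z) where

    -- Used for `_≼_` below, which is only a preorder: distinct vertices may have the same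
    -- in-neighbours in `M`.
    minimum : ∀ {x} → P x → (l : List A) → ∃[ m ] (P m × (∀ {y} → y L.∈ l → P y → R m y))
    minimum Px [] = _ , Px , λ ()
    minimum Px (y ∷ l) with minimum Px l | P? y
    ... | m , Pm , k | no ¬Py = m , Pm , λ { (here refl) Py → contradiction Py ¬Py ; (there i) → k i }
    ... | m , Pm , k | yes Py with total Pm Py
    ...   | inj₁ my = m , Pm , λ { (here refl) _ → my ; (there i) → k i }
    ...   | inj₂ ym = y , Py , λ
      -- Reflexivity comes from totality at equal arguments.
      { (here refl) _ → [ (λ r → r) , (λ r → r) ] (total Py Py)
      ; (there i) Pz → transitive Py Pm Pz ym (k i Pz) }

  -- `no-two` and `replace` are the hypergraph module condition on `X`, split into its two demands:
  -- a crossing edge meets `M` once, and its vertex in `M` is exchangeable.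
  module _ {X M : VSet} (X? : Decidable X) (M? : Decidable M)
    (no-two : ∀ {a b x} → X a → M a → X b → M b → X x → ¬ M x → a ≢ b → ¬ Cyc a b x)
    (replace : ∀ {a b x y} → X a → M a → X b → M b → X x → ¬ M x → X y → ¬ M y →
               Cyc a x y → Cyc b x y)
    {a₀ b₀ c₀ : V} (Xa₀ : X a₀) (Ma₀ : M a₀) (Xb₀ : X b₀) (Mb₀ : M b₀) (Xc₀ : X c₀) (¬Mc₀ : ¬ M c₀)
    (a₀≢b₀ : a₀ ≢ b₀) where

    private
      MX Out Split : VSet
      MX z = X z × M z
      Out z = X z × ¬ M z
      Split x = ∃[ a ] ∃[ b ] (MX a × MX b × arc x a ≡ false × arc x b ≡ true)

      Out? : Decidable Out
      Out? z = X? z ×-dec ¬? (M? z)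

      Split? : Decidable Split
      Split? x = any? λ a → any? λ b → (X? a ×-dec M? a) ×-dec (X? b ×-dec M? b)
        ×-dec (arc x a 𝔹.≟ false) ×-dec (arc x b 𝔹.≟ true)

      M-Out : ∀ {a x} → MX a → Out x → a ≢ x
      M-Out (_ , Ma) (_ , ¬Mx) refl = ¬Mx Ma

      unsplit : ∀ {y a b} → ¬ Split y → MX a → MX b → arc y a ≡ arc y b
      unsplit {y} {a} {b} ¬s Ma Mb with arc y a in p | arc y b in q
      ... | true  | true  = refl
      ... | false | false = refl
      ... | true  | false = contradiction (b , a , Mb , Ma , q , p) ¬s
      ... | false | true  = contradiction (a , b , Ma , Mb , p , q) ¬s

      pick : ∀ {x} → Out x → Split x → ∀ p → ∃[ m ] ∃[ m′ ]
             (MX m × MX m′ × arc m x ≡ p × arc m′ x ≡ not p)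
      pick Ox (a , b , Ma , Mb , p , q) true  =
        a , b , Ma , Mb , trans (anti (M-Out Ma Ox ∘ sym)) (cong not p) ,
                          trans (anti (M-Out Mb Ox ∘ sym)) (cong not q)
      pick Ox (a , b , Ma , Mb , p , q) false =
        b , a , Mb , Ma , trans (anti (M-Out Mb Ox ∘ sym)) (cong not q) ,
                          trans (anti (M-Out Ma Ox ∘ sym)) (cong not p)

      -- Otherwise some `u` in `M` makes `u`, `x`, `y` a 3-cycle. Replacing `u` by `u′`, whose arc
      -- to `x` is opposite, would have to preserve it.
      absorb : ∀ {x y m} → Out x → Split x → Out y → ¬ Split y → MX m → arc y x ≡ arc y m
      absorb {x} {y} {m} Ox sx Oy ¬sy Mm with pick Ox sx (arc y m)
      ... | u , u′ , Mu , Mu′ , ux , u′x = decidable-stable (arc y x 𝔹.≟ arc y m) λ ne →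
        let x≢y : x ≢ y
            x≢y = λ { refl → ¬sy sx }
            xy : arc x y ≡ arc y m
            xy = trans (anti (x≢y ∘ sym)) (trans (cong not (𝔹.¬-not ne)) (𝔹.not-involutive _))
            yu : arc y u ≡ arc y m
            yu = unsplit ¬sy Mu Mm
            (e , _) = replace (proj₁ Mu) (proj₂ Mu) (proj₁ Mu′) (proj₂ Mu′)
                        (proj₁ Ox) (proj₂ Ox) (proj₁ Oy) (proj₂ Oy)
                        (trans ux (sym xy) , trans xy (sym yu))
        in 𝔹.not-¬ refl (sym (trans (sym u′x) (trans e xy)))

      -- The in-neighbours within M of the splitting vertices form a chain.
      _≼_ : V → V → Set
      x ≼ y = ∀ a → MX a → arc a x ≡ true → arc a y ≡ true

      -- If some `a` in `M` dominated `x` but not `y`, then `a`, `x`, `y` would be a 3-cycle,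
      -- destroyed by replacing `a` with a vertex of `M` that `x` dominates.
      arc-≼ : ∀ {x y} → Out x → Split x → Out y → x ≢ y → arc x y ≡ true → x ≼ y
      arc-≼ {x} {y} Ox sx Oy x≢y xy a Ma ax with arc a y in ay | pick Ox sx true
      ... | true  | _ = refl
      ... | false | _ , b , _ , Mb , _ , bx with
            replace (proj₁ Ma) (proj₂ Ma) (proj₁ Mb) (proj₂ Mb) (proj₁ Ox) (proj₂ Ox) (proj₁ Oy) (proj₂ Oy)
              (trans ax (sym xy) , trans xy (sym (trans (anti (M-Out Ma Oy)) (cong not ay))))
      ...   | e , _ with trans (sym bx) (trans e xy)
      ...     | ()

    cyclicModule⇒NontrivialModule : NontrivialModule X
    cyclicModule⇒NontrivialModule with any? (λ c → Out? c ×-dec ¬? (Split? c))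
    -- Some outside vertex does not split `M`. Adding the splitting vertices to `M` leaves `c` out,
    -- and `absorb` makes the result a module.
    ... | yes (c , (Xc , ¬Mc) , ¬sc) = record
      { M = λ z → M z ⊎ Split z ; M? = λ z → M? z ⊎-dec Split? z
      ; const = λ Xx ¬Mx Xa Ma Xb Mb → trans (eq Xx ¬Mx Xa Ma) (sym (eq Xx ¬Mx Xb Mb))
      ; Xa = Xa₀ ; Ma = inj₁ Ma₀ ; Xb = Xb₀ ; Mb = inj₁ Mb₀ ; Xc = Xc ; ¬Mc = [ ¬Mc , ¬sc ] ; a≢b = a₀≢b₀ }
      where
      eq : ∀ {x a} → X x → ¬ (M x ⊎ Split x) → X a → M a ⊎ Split a → arc x a ≡ arc x a₀
      eq {x} {a} Xx ¬Mx Xa m with M? a | m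
      ... | yes Ma | _ = unsplit (¬Mx ∘ inj₂) (Xa , Ma) (Xa₀ , Ma₀)
      ... | no ¬Ma | inj₁ Ma = contradiction Ma ¬Ma
      ... | no ¬Ma | inj₂ sa = absorb (Xa , ¬Ma) sa (Xx , ¬Mx ∘ inj₁) (¬Mx ∘ inj₂) (Xa₀ , Ma₀)
    -- Every outside vertex splits `M`. Let `S` be the in-neighbours in `M` of the least one, `x`.
    -- All of `S` dominates everything not in `S`, so the complement of `S` is a module; it contains
    -- `x` and a vertex of `M` dominated by `x`.
    ... | no ¬c with minimum Out? _≼_ total (λ _ _ _ f g a Ma → g a Ma ∘ f a Ma) (Xc₀ , ¬Mc₀) (allFin n)
      where
      split : ∀ {x} → Out x → Split x
      split {x} Ox = decidable-stable (Split? x) λ ¬s → ¬c (x , Ox , ¬s)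
      total : ∀ {x y} → Out x → Out y → x ≼ y ⊎ y ≼ x
      total {x} {y} Ox Oy with x ≟ y | arc x y in xy
      ... | yes refl | _ = inj₁ λ _ _ e → e
      ... | no x≢y | true = inj₁ (arc-≼ Ox (split Ox) Oy x≢y xy)
      ... | no x≢y | false = inj₂ (arc-≼ Oy (split Oy) Ox (x≢y ∘ sym) (trans (anti x≢y) (cong not xy)))
    ... | x , Ox , least with pick Ox (decidable-stable (Split? x) λ ¬s → ¬c (x , Ox , ¬s)) true
    ... | a , b , (Xa , Ma) , (Xb , Mb) , ax , bx = record
      { M = λ z → ¬ S z ; M? = λ z → ¬? (M? z ×-dec (arc z x 𝔹.≟ true))
      ; const = λ {s} Xs ¬¬S Xa Ma Xb Mb → trans (eq Xs ¬¬S Xa Ma) (sym (eq Xs ¬¬S Xb Mb))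
      ; Xa = proj₁ Ox ; Ma = proj₂ Ox ∘ proj₁
      ; Xb = Xb ; Mb = λ (_ , bx′) → contradiction (trans (sym bx) bx′) λ ()
      ; Xc = Xa ; ¬Mc = λ f → f (Ma , ax) ; a≢b = M-Out (Xb , Mb) Ox ∘ sym }
      where
      S : VSet
      S z = M z × arc z x ≡ true
      eq : ∀ {s z} → X s → ¬ ¬ S s → X z → ¬ S z → arc s z ≡ true
      eq {s} {z} Xs ¬¬S Xz ¬Sz with decidable-stable (M? s ×-dec (arc s x 𝔹.≟ true)) ¬¬S
      ... | Ms , sx with M? z
      ...   | no ¬Mz = least (L.∈-allFin z) (Xz , ¬Mz) s (Xs , Ms) sx
      ...   | yes Mz with arc s z in sz
      ...     | true = refl
      -- The 3-cycle `z`, `s`, `x` would have two vertices in `M`.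
      ...     | false = contradiction
                (trans (trans (anti s≢z) (cong not sz)) (sym sx) , trans sx (sym xz))
                (no-two Xz Mz Xs Ms (proj₁ Ox) (proj₂ Ox) (s≢z ∘ sym))
        where
        zx : arc z x ≡ false
        zx = 𝔹.¬-not λ e → ¬Sz (Mz , e)
        s≢z : s ≢ z
        s≢z refl = ¬Sz (Ms , sx)
        xz : arc x z ≡ true
        xz = trans (anti (M-Out (Xz , Mz) Ox)) (cong not zx)

-- Ille's indecomposability graph and its walks.

module Walks {n} (arc : Fin n → Fin n → Bool)
             (anti : ∀ {x y} → x ≢ y → arc y x ≡ not (arc x y)) where
  open Primality arc anti
  open Growth arc anti

  private variable
    x y z u a b : V

  -- Adjacency in Ille's indecomposability graph.

  I : V → V → Set₁
  I x y = x ≢ y × PrimeOn (Off₂ x y)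

  I-sym : I x y → I y x
  I-sym (x≢y , P) = x≢y ∘ sym , PrimeOn-resp (λ (p , q) → q , p) (λ (p , q) → q , p) P

  module _ (y u : V) where

    swap : V → V
    swap z with z ≟ y | z ≟ u
    ... | yes _ | _     = u
    ... | no _  | yes _ = y
    ... | no _  | no _  = z

    swap-involutive : ∀ z → swap (swap z) ≡ z
    swap-involutive z with z ≟ y | z ≟ u
    swap-involutive z | yes refl | _ with u ≟ z | u ≟ u
    ... | yes refl | _ = refl
    ... | no _ | yes _ = refl
    ... | no _ | no u≢u = contradiction refl u≢u
    swap-involutive z | no z≢y | yes refl with y ≟ y
    ... | yes _ = refl
    ... | no y≢y = contradiction refl y≢y
    swap-involutive z | no z≢y | no z≢u with z ≟ y | z ≟ u
    ... | yes z≡y | _ = contradiction z≡y z≢y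
    ... | no _ | yes z≡u = contradiction z≡u z≢u
    ... | no _ | no _ = refl

    module _ {x} (y≢x : y ≢ x) (u∈ : Off₂ x y u) (tw : Twin (Off₂ x y) y u) where

      swap-off : Off₂ x y z → Off₂ x u (swap z)
      swap-off {z = z} (z≢x , z≢y) with z ≟ y | z ≟ u
      ... | yes z≡y | _        = contradiction z≡y z≢y
      ... | no _    | yes refl = y≢x , z≢y ∘ sym
      ... | no _    | no z≢u   = z≢x , z≢u

      swap-on : Off₂ x u z → Off₂ x y (swap z)
      swap-on {z = z} (z≢x , z≢u) with z ≟ y | z ≟ u
      ... | yes _  | _       = u∈
      ... | no _   | yes z≡u = contradiction z≡u z≢u
      ... | no z≢y | no _    = z≢x , z≢y

      swap-arc : Off₂ x y z → Off₂ x y a → z ≢ a → arc z a ≡ arc (swap z) (swap a)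
      swap-arc {z = z} {a} z∈@(_ , z≢y) a∈@(_ , a≢y) z≢a with z ≟ y | z ≟ u | a ≟ y | a ≟ u
      ... | yes z≡y | _ | _ | _ = contradiction z≡y z≢y
      ... | no _ | _ | yes a≡y | _ = contradiction a≡y a≢y
      ... | no _ | yes refl | no _ | yes refl = contradiction refl z≢a
      ... | no _ | yes refl | no _ | no a≢u = flip-arcs a≢u a≢y (sym (tw a a∈ a≢u))
      ... | no _ | no z≢u | no _ | yes refl = sym (tw z z∈ z≢u)
      ... | no _ | no _ | no _ | no _ = refl

      swap-injective : swap a ≡ swap b → a ≡ b
      swap-injective {a = a} {b} e =
        trans (sym (swap-involutive a)) (trans (cong swap e) (swap-involutive b))

      -- Since `y` and `u` are twins, exchanging them is an isomorphism between the tournaments left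
      -- after deleting `x`, `y` and after deleting `x`, `u`.
      I-swap : I x y → I x u
      I-swap (x≢y , primeOn t ¬N) = proj₁ u∈ ∘ sym , primeOn t′ (¬N ∘ N′)
        where
        t′ : Three (Off₂ x u)
        t′ = three (swap-off Xp) (swap-off Xq) (swap-off Xr)
                   (p≢q ∘ swap-injective) (p≢r ∘ swap-injective) (q≢r ∘ swap-injective)
          where open Three t
        N′ : NontrivialModule (Off₂ x u) → NontrivialModule (Off₂ x y)
        N′ N = record
          { M = M ∘ swap ; M? = λ z → M? (swap z)
          ; const = λ Xz ¬Mz Xa Ma Xb Mb →
              trans (swap-arc Xz Xa (λ { refl → ¬Mz Ma }))
              (trans (const (swap-off Xz) ¬Mz (swap-off Xa) Ma (swap-off Xb) Mb)
                     (sym (swap-arc Xz Xb (λ { refl → ¬Mz Mb }))))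
          ; Xa = swap-on Xa ; Ma = back Ma ; Xb = swap-on Xb ; Mb = back Mb
          ; Xc = swap-on Xc ; ¬Mc = λ m → ¬Mc (subst M (swap-involutive c) m)
          ; a≢b = a≢b ∘ swap-injective }
          where
          open NontrivialModule N
          back : ∀ {z} → M z → M (swap (swap z))
          back {z} = subst M (sym (swap-involutive z))

  -- For adjacent x and y: y is the only neighbour of x, respectively y and u are the only ones.

  Extremal : V → V → Set
  Extremal x y = Const (Off₂ x y) y

  Twins : V → V → V → Set
  Twins x y u = Off₂ x y u × Twin (Off₂ x y) y u

  -- A further neighbour `z` would leave `y` in the prime set `Off₂ x z` and constant on the rest of
  -- it.
  I-extremal : Extremal x y → I x y → I x z → z ≡ y
  I-extremal {x} {y} {z} c (x≢y , _) (x≢z , P) = decidable-stable (z ≟ y) λ z≢y →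
    no-const P (x≢y ∘ sym , z≢y ∘ sym)
      λ (a≢x , _) a≢y (b≢x , _) b≢y → c _ _ (a≢x , a≢y) (b≢x , b≢y)

  -- A further neighbour `z` would leave both `y` and `u` in the prime set `Off₂ x z`, as twins.
  I-twins : Twins x y u → I x y → I x z → z ≡ y ⊎ z ≡ u
  I-twins {x} {y} {u} {z} ((u≢x , u≢y) , tw) (x≢y , _) (x≢z , P) with z ≟ y | z ≟ u
  ... | yes z≡y | _ = inj₁ z≡y
  ... | no _ | yes z≡u = inj₂ z≡u
  ... | no z≢y | no z≢u = contradiction
    (sym (twins-equal P (x≢y ∘ sym , z≢y ∘ sym) (u≢x , z≢u ∘ sym)
      λ w (w≢x , _) w≢y w≢u → tw w (w≢x , w≢y) w≢u)) u≢y

  module Snoc {k} (v : ℕ → V) (injective : ∀ {i j} → i ≤ k → j ≤ k → v i ≡ v j → i ≡ j)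
              {u} (new : ∀ {i} → i ≤ k → v i ≢ u) where

    -- Sequences are total functions on `ℕ` read only up to their length, so `u` may fill every
    -- index beyond `k`.
    snoc : ℕ → V
    snoc i with i ℕ.≤? k
    ... | yes _ = v i
    ... | no _  = u

    snoc-old : ∀ {i} → i ≤ k → snoc i ≡ v i
    snoc-old {i} i≤k with i ℕ.≤? k
    ... | yes _ = refl
    ... | no i≰k = contradiction i≤k i≰k

    snoc-last : snoc (suc k) ≡ u
    snoc-last with suc k ℕ.≤? k
    ... | yes 1+k≤k = contradiction 1+k≤k ℕ.1+n≰n
    ... | no _ = refl

    old-or-last : ∀ {i} → i ≤ suc k → i ≤ k ⊎ i ≡ suc k
    old-or-last i≤ with ℕ.m≤n⇒m<n∨m≡n i≤
    ... | inj₁ (s≤s i≤k) = inj₁ i≤k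
    ... | inj₂ e = inj₂ e

    snoc-injective : ∀ {i j} → i ≤ suc k → j ≤ suc k → snoc i ≡ snoc j → i ≡ j
    snoc-injective i≤ j≤ e with old-or-last i≤ | old-or-last j≤
    ... | inj₁ i≤k | inj₁ j≤k = injective i≤k j≤k (trans (sym (snoc-old i≤k)) (trans e (snoc-old j≤k)))
    ... | inj₁ i≤k | inj₂ refl = contradiction (trans (sym (snoc-old i≤k)) (trans e snoc-last)) (new i≤k)
    ... | inj₂ refl | inj₁ j≤k = contradiction (trans (sym (snoc-old j≤k)) (trans (sym e) snoc-last)) (new j≤k)
    ... | inj₂ refl | inj₂ refl = refl

  module _ (crit : ∀ x → NontrivialModule (Off x)) where

    -- `Off x` is the prime set `Off₂ x y` together with `y`, and criticality makes it decomposable,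
    -- so `extend1` applies. In the twin case `I-swap` supplies the second neighbour.
    neighbours : I x y → Extremal x y ⊎ ∃[ u ] (Twins x y u × I x u)
    neighbours {x} {y} Ixy@(x≢y , P) with extend1 (Off₂? x y) P (λ (_ , y≢y) → y≢y refl)
      (NontrivialModule-resp [ proj₁ , (λ { refl → x≢y ∘ sym }) ] split (crit x))
      where
      split : ∀ {w} → Off x w → (Off₂ x y ∪′ y) w
      split {w} w≢x with w ≟ y
      ... | yes w≡y = inj₂ w≡y
      ... | no w≢y = inj₁ (w≢x , w≢y)
    ... | inj₁ c = inj₁ c
    ... | inj₂ (u , u∈ , tw) = inj₂ (u , (u∈ , tw) , I-swap y u (x≢y ∘ sym) u∈ tw Ixy)

    two-neighbours : I x y → I x u → y ≢ u → Twins x y u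
    two-neighbours {x} {y} {u} Ixy Ixu y≢u with neighbours Ixy
    ... | inj₁ c = contradiction (sym (I-extremal c Ixy Ixu)) y≢u
    ... | inj₂ (w , tw , _) with I-twins tw Ixy Ixu
    ...   | inj₁ u≡y = contradiction (sym u≡y) y≢u
    ...   | inj₂ refl = tw

    record Walk (k : ℕ) : Set₁ where
      field
        v         : ℕ → V
        injective : ∀ {i j} → i ≤ k → j ≤ k → v i ≡ v j → i ≡ j
        edge      : ∀ {i} → i < k → I (v i) (v (suc i))

    open Walk

    data Outcome (x y : V) : Set₁ where
      stops  : ∀ k (w : Walk (suc k)) → v w 0 ≡ x → v w 1 ≡ y →
               Extremal (v w (suc k)) (v w k) → Outcome x y
      cycles : ∀ k (w : Walk (2 + k)) → I (v w (2 + k)) (v w 0) → Outcome x y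

    append : ∀ {k} (w : Walk k) {u} → (∀ {i} → i ≤ k → v w i ≢ u) → I (v w k) u →
             Σ (Walk (suc k)) λ w′ → v w′ (suc k) ≡ u × (∀ {i} → i ≤ k → v w′ i ≡ v w i)
    append {k} w {u} new Iu = record { v = snoc ; injective = snoc-injective ; edge = edge′ } , snoc-last , snoc-old
      where
      open Snoc (v w) (injective w) new
      edge′ : ∀ {i} → i < suc k → I (snoc i) (snoc (suc i))
      edge′ {i} (s≤s i≤k) with ℕ.m≤n⇒m<n∨m≡n i≤k
      ... | inj₁ i<k = subst₂ I (sym (snoc-old i≤k)) (sym (snoc-old i<k)) (edge w i<k)
      ... | inj₂ refl = subst₂ I (sym (snoc-old i≤k)) (sym snoc-last) Iu

    walk-bound : ∀ {k} → Walk k → suc k ≤ n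
    walk-bound {k} w = injective⇒≤ {f = v w ∘ toℕ {suc k}}
      λ {i} {j} e → toℕ-injective (injective w (ℕ.≤-pred (toℕ<n i)) (ℕ.≤-pred (toℕ<n j)) e)

    -- The fuel `f` bounds the vertices not yet visited. If the last vertex has a second neighbour
    -- `u`, then `u` either is new and is appended, or is the start and closes a cycle.
    extend : ∀ {k} f → n ≤ f + suc k → (w : Walk (suc k)) → Outcome (v w 0) (v w 1)
    extend zero n≤ w = contradiction (ℕ.≤-trans (walk-bound w) n≤) ℕ.1+n≰n
    extend {k} (suc f) n≤ w with neighbours (I-sym (edge w (ℕ.n<1+n k)))
    ... | inj₁ c = stops k w refl refl c
    ... | inj₂ (u , ((u≢l , u≢p) , _) , Iu) with any? (λ (i : Fin (2 + k)) → v w (toℕ i) ≟ u)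
    ...   | no ¬i with append w (λ {i} i≤ e → ¬i (fromℕ< (s≤s i≤) , trans (cong (v w) (toℕ-fromℕ< (s≤s i≤))) e)) Iu
    ...     | w′ , _ , old = subst₂ Outcome (old z≤n) (old (s≤s z≤n))
                (extend f (subst (n ≤_) (sym (ℕ.+-suc f (suc k))) n≤) w′)
    -- On a walk of two vertices the start is the predecessor of the last vertex, which `u` is not.
    extend {zero} (suc f) n≤ w | inj₂ (u , ((u≢l , u≢p) , _) , Iu) | yes (zero , e) = contradiction (sym e) u≢p
    extend {suc k} (suc f) n≤ w | inj₂ (u , ((u≢l , u≢p) , _) , Iu) | yes (zero , e) =
      cycles k w (subst (I _) (sym e) Iu)
    extend {k} (suc f) n≤ w | inj₂ (u , ((u≢l , u≢p) , _) , Iu) | yes (suc i , e) =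
      go (toℕ i) (ℕ.≤-pred (toℕ<n i)) e
      where
      -- An inner vertex `v w (suc j)` has its two walk neighbours and no others, so the last vertex
      -- would be one of them; injectivity leaves only the case where `u` is the predecessor.
      go : ∀ j → j ≤ k → v w (suc j) ≡ u → _
      go j j≤k e = [ (λ l≡ → contradiction (injective w ℕ.≤-refl (ℕ.m≤n⇒m≤1+n j≤k) l≡) (ℕ.<⇒≢ (s≤s j≤k) ∘ sym))
                   , (λ l≡ → contradiction (ℕ.suc-injective (injective w ℕ.≤-refl (s≤s j<k) l≡))
                                (1+j≢k ∘ sym)) ]
        (I-twins (two-neighbours (I-sym (edge w j<1+k)) (edge w 1+j<1+k)
                    λ e′ → ℕ.<⇒≢ (ℕ.m<n⇒m<1+n (ℕ.n<1+n j)) (injective w (ℕ.<⇒≤ j<1+k) 1+j<1+k e′))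
                 (I-sym (edge w j<1+k)) (subst (λ x → I x (v w (suc k))) (sym e) (I-sym Iu)))
        where
        j≢k : j ≢ k
        j≢k refl = u≢l (sym e)
        j<k : j < k
        j<k = ℕ.≤∧≢⇒< j≤k j≢k
        1+j≢k : suc j ≢ k
        1+j≢k refl = u≢p (sym e)
        j<1+k : j < suc k
        j<1+k = s≤s j≤k
        1+j<1+k : suc j < suc k
        1+j<1+k = s≤s j<k

    data Shape : Set₁ where
      path  : ∀ k (w : Walk (suc k)) → Extremal (v w 0) (v w 1) →
              Extremal (v w (suc k)) (v w k) → Shape
      cycle : ∀ k (w : Walk (2 + k)) → I (v w (2 + k)) (v w 0) → Shape

    single : I x y → Σ (Walk 1) λ w → v w 0 ≡ x × v w 1 ≡ y
    single {x} {y} Ixy@(x≢y , _) =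
      record { v = λ { zero → x ; (suc _) → y } ; injective = inj′ ; edge = λ { (s≤s z≤n) → Ixy } }
      , refl , refl
      where
      inj′ : ∀ {i j} → i ≤ 1 → j ≤ 1 → _ ≡ _ → i ≡ j
      inj′ z≤n z≤n _ = refl
      inj′ z≤n (s≤s z≤n) e = contradiction e x≢y
      inj′ (s≤s z≤n) z≤n e = contradiction (sym e) x≢y
      inj′ (s≤s z≤n) (s≤s z≤n) _ = refl

    outcome : I x y → Outcome x y
    outcome Ixy with single Ixy
    ... | w , refl , refl = extend n (ℕ.m≤m+n n 1) w

    shape : I x y → Shape
    shape Ixy with outcome Ixy
    ... | cycles k w e = cycle k w e
    -- The walk is restarted backwards from its extremal end, so that both ends of the new walk are
    -- extremal.
    ... | stops k w _ _ c with outcome (I-sym (edge w (ℕ.n<1+n k)))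
    ...   | cycles k′ w′ e = cycle k′ w′ e
    ...   | stops k′ w′ e₀ e₁ c′ = path k′ w′ (subst₂ Extremal (sym e₀) (sym e₁) c) c′

-- Parity and the arc patterns of the three families.

parity : ℕ → Bool
parity zero    = false
parity (suc i) = not (parity i)

parity-2* : ∀ m → parity (2 * m) ≡ false
parity-2* zero = refl
parity-2* (suc m) rewrite ℕ.+-suc m (m + 0) = trans (𝔹.not-involutive _) (parity-2* m)

halve : ∀ k → ∃[ m ] (k ≡ 2 * m ⊎ k ≡ suc (2 * m))
halve zero = 0 , inj₁ refl
halve (suc k) with halve k
... | m , inj₁ refl = m , inj₂ refl
... | m , inj₂ refl = suc m , inj₁ (cong suc (sym (ℕ.+-suc m (m + 0))))

data Kind : Set where
  kindT kindU kindW : Kind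

-- The arc from i to j, i < j ≤ 2 m, in the tournament of the given kind on {0, …, 2 m}.

pattern-arc : Kind → ℕ → ℕ → ℕ → Bool
pattern-arc kindT m i j = not (parity i xor parity j)
pattern-arc kindU m i j = parity i ∨ parity j
pattern-arc kindW m i j = if does (j ℕ.≟ 2 * m) then parity i else true

pattern-arcW-last : ∀ m i {j} → j ≡ 2 * m → pattern-arc kindW m i j ≡ parity i
pattern-arcW-last m i {j} e = cong (if_then parity i else true) (dec-true (j ℕ.≟ 2 * m) e)

pattern-arcW-inner : ∀ m i {j} → j ≢ 2 * m → pattern-arc kindW m i j ≡ true
pattern-arcW-inner m i {j} ne = cong (if_then parity i else true) (dec-false (j ℕ.≟ 2 * m) ne)

-- Boolean equality: `false` as sign reverses all arcs. Matching on the second argument lets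
-- `signed s true` reduce to `s`.
signed : Bool → Bool → Bool
signed s true  = s
signed s false = not s

-- Reading the labelling off a path or a cycle.

module Labels {n} (arc : Fin n → Fin n → Bool)
              (anti : ∀ {x y} → x ≢ y → arc y x ≡ not (arc x y)) where
  open Primality arc anti
  open Growth arc anti
  open Walks arc anti

  record Labelling : Set where
    field
      kind       : Kind
      m          : ℕ
      1≤m        : 1 ≤ m
      sign       : Bool
      v          : ℕ → V
      injective  : ∀ {i j} → i ≤ 2 * m → j ≤ 2 * m → v i ≡ v j → i ≡ j
      surjective : ∀ z → ∃[ i ] (i ≤ 2 * m × v i ≡ z)
      arcs       : ∀ {i j} → i < j → j ≤ 2 * m → arc (v i) (v j) ≡ signed sign (pattern-arc kind m i j)

  module _ (¬NF : ¬ NontrivialModule Full) (crit : ∀ x → NontrivialModule (Off x)) where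

    module Arcs {K} (w : Walk crit K) where
      open Walk w public

      distinct : ∀ {i j} → i ≤ K → j ≤ K → i ≢ j → v i ≢ v j
      distinct i≤ j≤ i≢j e = i≢j (injective i≤ j≤ e)

      twins : ∀ {i} → 2 + i ≤ K → Twins (v (1 + i)) (v i) (v (2 + i))
      twins {i} le = two-neighbours crit (I-sym (edge (ℕ.<⇒≤ le))) (edge le)
        (distinct (ℕ.<⇒≤ (ℕ.<⇒≤ le)) le (ℕ.<⇒≢ (ℕ.m<n⇒m<1+n (ℕ.n<1+n i))))

      twins-at : ∀ {i z} → 2 + i ≤ K → z ≢ v i → z ≢ v (1 + i) → z ≢ v (2 + i) →
                 arc z (v i) ≡ arc z (v (2 + i))
      twins-at {z = z} le a b c = proj₂ (twins le) z (b , a) c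

      -- `v j` and `v (2 + j)` are twins apart from the vertex between them, and `v i` is not that
      -- vertex; `shift-left` does the same for the other end.
      shift-right : ∀ {i j} → i < j → 2 + j ≤ K → arc (v i) (v (2 + j)) ≡ arc (v i) (v j)
      shift-right {i} {j} i<j le = sym (twins-at le (ne i<j j≤) (ne (ℕ.m<n⇒m<1+n i<j) (ℕ.<⇒≤ le))
                                     (ne (ℕ.m<n⇒m<1+n (ℕ.m<n⇒m<1+n i<j)) le))
        where
        j≤ : j ≤ K
        j≤ = ℕ.<⇒≤ (ℕ.<⇒≤ le)
        ne : ∀ {l} → i < l → l ≤ K → v i ≢ v l
        ne i<l l≤ = distinct (ℕ.<⇒≤ (ℕ.<-≤-trans i<l l≤)) l≤ (ℕ.<⇒≢ i<l)

      shift-left : ∀ {i j} → 2 + i < j → j ≤ K → arc (v (2 + i)) (v j) ≡ arc (v i) (v j)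
      shift-left {i} {j} lt j≤ = flip-arcs (ne lt) (ne i<j) (sym (twins-at (ℕ.<⇒≤ (ℕ.<-≤-trans lt j≤))
                                  (ne i<j) (ne (ℕ.<⇒≤ lt)) (ne lt)))
        where
        i<j : i < j
        i<j = ℕ.<⇒≤ (ℕ.<⇒≤ lt)
        ne : ∀ {l} → l < j → v j ≢ v l
        ne l<j = distinct j≤ (ℕ.<⇒≤ (ℕ.<-≤-trans l<j j≤)) (ℕ.<⇒≢ l<j ∘ sym)

      -- `v i` and `v (2 + i)` are twins apart from `v (1 + i)`. If that vertex did not distinguish
      -- them either, they would form a module of the whole tournament.
      consecutive : ∀ {i} → 2 + i ≤ K → arc (v (1 + i)) (v (2 + i)) ≡ arc (v i) (v (1 + i))
      consecutive {i} le with twins le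
      ... | (c≢b , c≢a) , tw = trans
        (𝔹.¬-not λ e → ¬NF (pair-ntm tt tt (c≢a ∘ sym) (λ z _ → agree e z) (v (1 + i) , tt , b≢a , c≢b ∘ sym)))
        (trans (cong not (anti (b≢a ∘ sym))) (𝔹.not-involutive _))
        where
        b≢a : v (1 + i) ≢ v i
        b≢a = distinct (ℕ.<⇒≤ le) (ℕ.<⇒≤ (ℕ.<⇒≤ le)) (ℕ.<⇒≢ (ℕ.n<1+n i) ∘ sym)
        agree : arc (v (1 + i)) (v (2 + i)) ≡ arc (v (1 + i)) (v i) →
                ∀ z → z ≢ v i → z ≢ v (2 + i) → arc z (v i) ≡ arc z (v (2 + i))
        agree e z z≢a z≢c with z ≟ v (1 + i)
        ... | yes refl = sym e
        ... | no z≢b = twins-at le z≢a z≢b z≢c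

      base even odd : Bool
      base = arc (v 0) (v 1)
      even = arc (v 0) (v 2)
      odd  = arc (v 1) (v 3)

      colour : Bool → Bool → Bool
      colour p q = if p xor q then base else if p then odd else even

      -- Shifts by two bring `i` down to 0 or 1 and `j` down to at most 3. By `consecutive`, both
      -- kinds of arcs between opposite parities share the value `base`.
      formula : ∀ i j → i < j → j ≤ K → arc (v i) (v j) ≡ colour (parity i) (parity j)
      formula (suc (suc i)) j i<j j≤ =
        trans (shift-left i<j j≤) (trans (formula i j (ℕ.<⇒≤ (ℕ.<⇒≤ i<j)) j≤)
          (cong (λ p → colour p (parity j)) (sym (𝔹.not-involutive (parity i)))))
      formula 0 1 _ _ = refl
      formula 0 2 _ _ = refl
      formula 0 (suc (suc (suc j))) _ j≤ =
        trans (shift-right (s≤s z≤n) j≤) (trans (formula 0 (suc j) (s≤s z≤n) (ℕ.<⇒≤ (ℕ.<⇒≤ j≤)))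
          (cong (colour false) (sym (𝔹.not-involutive (not (parity j))))))
      formula 1 2 _ 2≤ = consecutive 2≤
      formula 1 3 _ _ = refl
      formula 1 (suc (suc (suc (suc j)))) _ j≤ =
        trans (shift-right (s≤s (s≤s z≤n)) j≤)
          (trans (formula 1 (suc (suc j)) (s≤s (s≤s z≤n)) (ℕ.<⇒≤ (ℕ.<⇒≤ j≤)))
            (cong (colour true) (sym (𝔹.not-involutive (not (not (parity j)))))))
      formula 1 1 (s≤s ()) _

      arc≡ : ∀ {i j p q} → i < j → j ≤ K → parity i ≡ p → parity j ≡ q → arc (v i) (v j) ≡ colour p q
      arc≡ i<j j≤ refl refl = formula _ _ i<j j≤

      arc≡ᵒ : ∀ {i j p q} → i < j → j ≤ K → parity i ≡ p → parity j ≡ q →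
              arc (v j) (v i) ≡ not (colour p q)
      arc≡ᵒ i<j j≤ refl refl =
        trans (anti (distinct (ℕ.<⇒≤ (ℕ.<-≤-trans i<j j≤)) j≤ (ℕ.<⇒≢ i<j))) (cong not (formula _ _ i<j j≤))

      Outside : V → Set
      Outside z = ∀ {i} → i ≤ K → z ≢ v i

      outside-arc : ∀ {z} → Outside z → ∀ i → i ≤ K → arc z (v i) ≡ (if parity i then arc z (v 1) else arc z (v 0))
      outside-arc out 0 _ = refl
      outside-arc out 1 _ = refl
      outside-arc out (suc (suc i)) i≤ rewrite 𝔹.not-involutive (parity i) = trans
        (sym (twins-at i≤ (out (ℕ.<⇒≤ (ℕ.<⇒≤ i≤))) (out (ℕ.<⇒≤ i≤)) (out i≤)))
        (outside-arc out i (ℕ.<⇒≤ (ℕ.<⇒≤ i≤)))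

      outside≡ : ∀ {z i j} → Outside z → i ≤ K → j ≤ K → parity i ≡ parity j → arc z (v i) ≡ arc z (v j)
      outside≡ {z} {i} {j} out i≤ j≤ e = trans (outside-arc out i i≤)
        (trans (cong (λ p → if p then arc z (v 1) else arc z (v 0)) e) (sym (outside-arc out j j≤)))

      locate : ∀ z → (∃[ i ] (i ≤ K × v i ≡ z)) ⊎ Outside z
      locate z with any? (λ (i : Fin (suc K)) → v (toℕ i) ≟ z)
      ... | yes (i , e) = inj₁ (toℕ i , ℕ.≤-pred (toℕ<n i) , e)
      ... | no ¬i = inj₂ λ {i} i≤ e → ¬i (fromℕ< (s≤s i≤) , trans (cong v (toℕ-fromℕ< (s≤s i≤))) (sym e))

    crowded : ∀ {x y} → I x y → ¬ (∀ {z z′} → Off₂ x y z → Off₂ x y z′ → z ≡ z′)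
    crowded (_ , primeOn (three Xp Xq _ p≢q _ _) _) k = p≢q (k Xp Xq)

    -- All vertices other than `x` would form a module. The edge serves to provide two of them.
    no-source : ∀ {x y c} → I x y → ¬ (∀ z → z ≢ x → arc x z ≡ c)
    no-source {x} (_ , primeOn (three Xp Xq _ p≢q _ _) _) k = ¬NF record
      { M = Off x ; M? = Off? x
      ; const = λ { {z} _ ¬Mz _ Ma _ Mb → subst (λ z → arc z _ ≡ arc z _)
                      (sym (decidable-stable (z ≟ x) ¬Mz)) (trans (k _ Ma) (sym (k _ Mb))) }
      ; Xa = tt ; Ma = proj₁ Xp ; Xb = tt ; Mb = proj₁ Xq ; Xc = tt ; ¬Mc = λ f → f refl ; a≢b = p≢q }

    module _ {k} (w : Walk crit (2 + k)) (closing : I (Walk.v w (2 + k)) (Walk.v w 0)) where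
      open Arcs w
      private
        K : ℕ
        K = 2 + k

      closing-twins : ∀ z → z ≢ v 0 → z ≢ v K → z ≢ v 1 → arc z (v K) ≡ arc z (v 1)
      closing-twins z z≢0 z≢K = proj₂ (two-neighbours crit (I-sym closing) (edge (s≤s z≤n))
        (distinct ℕ.≤-refl (s≤s z≤n) λ ())) z (z≢0 , z≢K)

      -- `v K` and `v 1` are twins of opposite parity, so an outside vertex would see the even and
      -- the odd positions alike and the whole cycle would be a module.
      cycle-covers : parity K ≡ false → ∀ z → ∃[ i ] (i ≤ K × v i ≡ z)
      cycle-covers even-K z with locate z
      ... | inj₁ covered = covered
      ... | inj₂ out = contradiction (record
        { M = M ; M? = M?
        ; const = λ _ ¬Mx _ Ma _ Mb → trans (eq ¬Mx Ma) (sym (eq ¬Mx Mb))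
        ; Xa = tt ; Ma = 0 , z≤n , refl ; Xb = tt ; Mb = 1 , s≤s z≤n , refl ; Xc = tt
        ; ¬Mc = λ (i , i≤ , e) → out i≤ (sym e)
        ; a≢b = distinct z≤n (s≤s z≤n) λ () }) ¬NF
        where
        M : VSet
        M y = ∃[ i ] (i ≤ K × v i ≡ y)
        M? : Decidable M
        M? y with locate y
        ... | inj₁ covered = yes covered
        ... | inj₂ out = no λ (i , i≤ , e) → out i≤ (sym e)
        eq : ∀ {x a} → ¬ M x → M a → arc x a ≡ arc x (v 0)
        eq {x} ¬Mx (i , i≤ , refl) with locate x
        ... | inj₁ covered = contradiction covered ¬Mx
        ... | inj₂ out with parity i in p
        ...   | false = outside≡ out i≤ z≤n p
        ...   | true = trans (outside≡ {j = 1} out i≤ (s≤s z≤n) p)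
                (trans (sym (closing-twins x (out z≤n) (out ℕ.≤-refl) (out (s≤s z≤n))))
                       (outside≡ {j = 0} out ℕ.≤-refl z≤n even-K))

    module _ {K} (w : Walk crit K) where
      open Arcs w

      label : ∀ kind {m} → K ≡ 2 * m → 1 ≤ K → (sign : Bool) → (∀ z → ∃[ i ] (i ≤ K × v i ≡ z)) →
              (∀ {i j} → i < j → j ≤ 2 * m →
                 colour (parity i) (parity j) ≡ signed sign (pattern-arc kind m i j)) → Labelling
      label kind {zero} refl () sign surjective match
      label kind {suc m} refl _ sign surjective match = record
        { kind = kind ; m = suc m ; 1≤m = s≤s z≤n ; sign = sign ; v = v
        ; injective = injective ; surjective = surjective
        ; arcs = λ i<j j≤ → trans (formula _ _ i<j j≤) (match i<j j≤) }

      label-T : ∀ {m} → K ≡ 2 * m → 1 ≤ K → (∀ z → ∃[ i ] (i ≤ K × v i ≡ z)) →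
                even ≡ not base → odd ≡ not base → Labelling
      -- `T₂ₙ₊₁` keeps the arcs between equal parities, so the sign is the value of those arcs.
      label-T {m} e 1≤ surjective even≡ odd≡ = label kindT {m} e 1≤ (not base) surjective λ {i} {j} _ _ → match (parity i) (parity j)
        where
        match : ∀ p q → colour p q ≡ signed (not base) (not (p xor q))
        match false false = even≡
        match false true  = sym (𝔹.not-involutive base)
        match true  false = sym (𝔹.not-involutive base)
        match true  true  = odd≡

      label-U : ∀ {m} → K ≡ 2 * m → 1 ≤ K → (∀ z → ∃[ i ] (i ≤ K × v i ≡ z)) →
                even ≡ not base → odd ≡ base → Labelling
      -- `U₂ₙ₊₁` reverses only the arcs between even vertices, so the sign is `base`.
      label-U {m} e 1≤ surjective even≡ odd≡ = label kindU {m} e 1≤ base surjective λ {i} {j} _ _ → match (parity i) (parity j)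
        where
        match : ∀ p q → colour p q ≡ signed base (p ∨ q)
        match false false = even≡
        match false true  = refl
        match true  false = refl
        match true  true  = odd≡

      uncovered-third : I (v 0) (v 1) → K ≤ 2 → ¬ (∀ z → ∃[ i ] (i ≤ K × v i ≡ z))
      uncovered-third I01 K≤2 surjective = crowded I01 λ z∈ z′∈ → trans (third z∈) (sym (third z′∈))
        where
        third : ∀ {z} → Off₂ (v 0) (v 1) z → z ≡ v 2
        third {z} (z≢0 , z≢1) with surjective z
        ... | 0 , _ , refl = contradiction refl z≢0
        ... | 1 , _ , refl = contradiction refl z≢1
        ... | 2 , _ , refl = refl
        ... | suc (suc (suc i)) , i≤ , _ with ℕ.≤-trans i≤ K≤2
        ...   | s≤s (s≤s ())

    cycle-label : ∀ k (w : Walk crit (2 + k)) → I (Walk.v w (2 + k)) (Walk.v w 0) → Labelling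
    cycle-label k w closing with halve (2 + k)
    cycle-label 0 w closing | m , inj₂ e = contradiction (trans (cong parity e) (cong not (parity-2* m))) λ ()
    -- With `K` odd, `v 2` sees `v K` with value `base` and `v 1` with value `not base`, although
    -- these two are twins.
    cycle-label (suc k) w closing | m , inj₂ e = contradiction
      (trans (sym (arc≡ (s≤s (s≤s (s≤s z≤n))) ℕ.≤-refl refl (trans (cong parity e) (cong not (parity-2* m)))))
      (trans (closing-twins w closing (v 2) (distinct 2≤ z≤n λ ()) (distinct 2≤ ℕ.≤-refl λ ()) (distinct 2≤ (s≤s z≤n) λ ()))
             (arc≡ᵒ (s≤s (s≤s z≤n)) 2≤ refl refl)))
      (𝔹.not-¬ refl)
      where
      open Arcs w
      2≤ : 2 ≤ 3 + k
      2≤ = s≤s (s≤s z≤n)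
    cycle-label 0 w closing | m , inj₁ e = contradiction (cycle-covers w closing refl)
      (uncovered-third w (Walk.edge w (s≤s z≤n)) (s≤s (s≤s z≤n)))
    cycle-label 1 w closing | m , inj₁ e = contradiction (trans (cong parity e) (parity-2* m)) λ ()
    -- With `K` even, comparing the twins `v K` and `v 1` from `v 2` determines `even`, and from
    -- `v 3` determines `odd`.
    cycle-label (suc (suc k)) w closing | m , inj₁ e = label-T w {m} e (s≤s z≤n)
      (cycle-covers w closing even-K)
      (trans (sym (arc≡ (s≤s (s≤s (s≤s z≤n))) ℕ.≤-refl refl even-K))
      (trans (closing-twins w closing (v 2) (distinct 2≤ z≤n λ ()) (distinct 2≤ ℕ.≤-refl λ ()) (distinct 2≤ 1≤ λ ()))
             (arc≡ᵒ (s≤s (s≤s z≤n)) 2≤ refl refl)))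
      (trans (sym (𝔹.not-involutive _)) (cong not (sym
      (trans (sym (arc≡ (s≤s (s≤s (s≤s (s≤s z≤n)))) ℕ.≤-refl refl even-K))
      (trans (closing-twins w closing (v 3) (distinct 3≤ z≤n λ ()) (distinct 3≤ ℕ.≤-refl λ ()) (distinct 3≤ 1≤ λ ()))
             (arc≡ᵒ (s≤s (s≤s z≤n)) 3≤ refl refl))))))
      where
      open Arcs w
      even-K : parity (4 + k) ≡ false
      even-K = trans (cong parity e) (parity-2* m)
      1≤ : 1 ≤ 4 + k
      1≤ = s≤s z≤n
      2≤ : 2 ≤ 4 + k
      2≤ = s≤s (s≤s z≤n)
      3≤ : 3 ≤ 4 + k
      3≤ = s≤s (s≤s (s≤s z≤n))

    path-label : ∀ k (w : Walk crit (suc k)) → Extremal (Walk.v w 0) (Walk.v w 1) →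
                 Extremal (Walk.v w (suc k)) (Walk.v w k) → Labelling
    path-label k w first last with halve (suc k)
    path-label 0 w first last | m , inj₁ e = contradiction (trans (cong parity e) (parity-2* m)) λ ()
    path-label (suc k) w first last | m , inj₁ e = result k refl
      where
      open Arcs w
      K : ℕ
      K = 2 + k
      even-K : parity K ≡ false
      even-K = trans (cong parity e) (parity-2* m)
      odd-k : parity (suc k) ≡ true
      odd-k = trans (sym (𝔹.not-involutive _)) (cong not even-K)
      ne : ∀ {i j} → i ≤ K → j ≤ K → i ≢ j → v i ≢ v j
      ne = distinct
      1≤ : 1 ≤ K
      1≤ = s≤s z≤n
      2≤ : 2 ≤ K
      2≤ = s≤s (s≤s z≤n)
      -- The odd positions 1 and `suc k` look alike from an outside `z`. Extremality at the start
      -- gives `v 1` the arc value `base` towards `z`; extremality at the end gives `v (suc k)` the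
      -- value `not base`.
      covers : ∀ z → ∃[ i ] (i ≤ K × v i ≡ z)
      covers z with locate z
      ... | inj₁ covered = covered
      ... | inj₂ out = contradiction (trans (sym z-first) (trans (flip-arcs (out 1≤) (out (ℕ.n≤1+n _)) z-same) z-last)) (𝔹.not-¬ refl)
        where
        z-same : arc z (v 1) ≡ arc z (v (suc k))
        z-same = outside≡ out 1≤ (ℕ.n≤1+n _) (sym odd-k)
        z-first : arc (v 1) z ≡ base
        z-first = trans (first z (v 2) (out z≤n , out 1≤) (ne 2≤ z≤n (λ ()) , ne 2≤ 1≤ λ ()))
                        (arc≡ (s≤s (s≤s z≤n)) 2≤ refl refl)
        z-last : arc (v (suc k)) z ≡ not base
        z-last = trans (last z (v 0) (out ℕ.≤-refl , out (ℕ.n≤1+n _)) (ne z≤n ℕ.≤-refl (λ ()) , ne z≤n (ℕ.n≤1+n _) λ ()))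
                       (arc≡ᵒ (s≤s z≤n) (ℕ.n≤1+n _) refl odd-k)
      result : ∀ k′ → k ≡ k′ → Labelling
      result 0 refl = contradiction covers (uncovered-third w (edge (s≤s z≤n)) ℕ.≤-refl)
      result (suc k′) refl = label-U w {m} e (s≤s z≤n) covers (𝔹.¬-not even≢) odd≡
        where
        odd≡ : odd ≡ base
        odd≡ = trans (first (v 3) (v 2) (ne 3≤ z≤n (λ ()) , ne 3≤ 1≤ λ ()) (ne 2≤ z≤n (λ ()) , ne 2≤ 1≤ λ ()))
                     (arc≡ (s≤s (s≤s z≤n)) 2≤ refl refl)
          where
          3≤ : 3 ≤ K
          3≤ = s≤s (s≤s (s≤s z≤n))
        -- Equality would make `v 0` dominate, or be dominated by, every other vertex.
        even≢ : even ≢ base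
        even≢ eq = no-source (edge {0} (s≤s z≤n)) λ z z≢0 → source z z≢0 (covers z)
          where
          source : ∀ z → z ≢ v 0 → ∃[ i ] (i ≤ K × v i ≡ z) → arc (v 0) z ≡ base
          source z z≢0 (0 , _ , refl) = contradiction refl z≢0
          source z z≢0 (suc i , i≤ , refl) with parity (suc i) in p
          ... | false = trans (arc≡ (s≤s z≤n) i≤ refl p) eq
          ... | true  = arc≡ (s≤s z≤n) i≤ refl p
    path-label k w first last | m , inj₂ e = result k refl
      where
      open Arcs w
      K : ℕ
      K = suc k
      even-k : parity k ≡ false
      even-k = trans (cong parity (ℕ.suc-injective e)) (parity-2* m)
      k≤ : k ≤ K
      k≤ = ℕ.n≤1+n k
      1≤ : 1 ≤ K
      1≤ = s≤s z≤n
      outside-even : ∀ {i z} → Outside z → i ≤ K → parity i ≡ false → arc (v i) z ≡ arc (v k) z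
      outside-even out i≤ p = flip-arcs (out i≤) (out k≤) (outside≡ out i≤ k≤ (trans p (sym even-k)))
      outside-odd : ∀ {i z} → Outside z → i ≤ K → parity i ≡ true → arc (v i) z ≡ arc (v 1) z
      outside-odd out i≤ p = flip-arcs (out i≤) (out 1≤) (outside≡ out i≤ 1≤ p)
      Outside? : Decidable Outside
      Outside? z with locate z
      ... | inj₁ (i , i≤ , e) = no λ out → out i≤ (sym e)
      ... | inj₂ out = yes out
      -- The arc from `v i` to an outside vertex is that of `v k` or of `v 1`, by parity, and
      -- extremality makes both of these constant on the outside vertices.
      outsiders-agree : ∀ {i a b} → i ≤ K → Outside a → Outside b → arc (v i) a ≡ arc (v i) b
      outsiders-agree {i} {a} {b} i≤ outa outb with parity i in p
      ... | false = trans (outside-even outa i≤ p)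
        (trans (last a b (outa ℕ.≤-refl , outa k≤) (outb ℕ.≤-refl , outb k≤)) (sym (outside-even outb i≤ p)))
      ... | true = trans (outside-odd outa i≤ p)
        (trans (first a b (outa z≤n , outa 1≤) (outb z≤n , outb 1≤)) (sym (outside-odd outb i≤ p)))
      -- Otherwise the outside vertices form a nontrivial module.
      unique : ∀ {a b} → Outside a → Outside b → a ≡ b
      unique {a} {b} outa outb = decidable-stable (a ≟ b) λ a≢b → ¬NF record
        { M = Outside ; M? = Outside?
        ; const = λ {x} _ ¬Mx _ Ma _ Mb → const x ¬Mx Ma Mb
        ; Xa = tt ; Ma = outa ; Xb = tt ; Mb = outb ; Xc = tt ; ¬Mc = λ out → out {0} z≤n refl ; a≢b = a≢b }
        where
        const : ∀ x {a b} → ¬ Outside x → Outside a → Outside b → arc x a ≡ arc x b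
        const x ¬Mx outa outb with locate x
        ... | inj₁ (i , i≤ , refl) = outsiders-agree i≤ outa outb
        ... | inj₂ out = contradiction {A = Outside x} out ¬Mx
      -- Extremality at the end: `v k` does not distinguish `v 0` from `v 1`.
      even≡ : 2 ≤ k → even ≡ base
      even≡ 2≤k = 𝔹.not-injective
        (trans (sym (arc≡ᵒ (ℕ.<⇒≤ 2≤k) k≤ refl even-k))
        (trans (last (v 0) (v 1) (distinct z≤n ℕ.≤-refl (λ ()) , distinct z≤n k≤ (ℕ.<⇒≢ (ℕ.<⇒≤ 2≤k)))
                                 (distinct 1≤ ℕ.≤-refl (ℕ.<⇒≢ (s≤s (ℕ.<⇒≤ 2≤k))) , distinct 1≤ k≤ (ℕ.<⇒≢ 2≤k)))
               (arc≡ᵒ 2≤k k≤ refl even-k)))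
      result : ∀ k′ → k ≡ k′ → Labelling
      result 0 refl = ⊥-elim (crowded (edge {0} (s≤s z≤n)) λ z∈ z′∈ → unique (off z∈) (off z′∈))
        where
        off : ∀ {z} → Off₂ (v 0) (v 1) z → Outside z
        off (z≢0 , _) {0} _ = z≢0
        off (_ , z≢1) {1} _ = z≢1
        off _ {suc (suc _)} (s≤s ())
      result 1 refl = contradiction even-k λ ()
      result (suc (suc k′)) refl with any? Outside?
      -- Without an outside vertex, all arcs from `v 0` have the value `base`.
      ... | no ¬out = ⊥-elim (no-source (edge {0} (s≤s z≤n)) λ z z≢0 → source z z≢0 (covered z))
        where
        covered : ∀ z → ∃[ i ] (i ≤ K × v i ≡ z)
        covered z with locate z
        ... | inj₁ i = i
        ... | inj₂ out = contradiction (z , λ {i} → out {i}) ¬out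
        source : ∀ z → z ≢ v 0 → ∃[ i ] (i ≤ K × v i ≡ z) → arc (v 0) z ≡ base
        source z z≢0 (0 , _ , refl) = contradiction refl z≢0
        source z z≢0 (suc i , i≤ , refl) with parity (suc i) in p
        ... | false = trans (arc≡ (s≤s z≤n) i≤ refl p) (even≡ (s≤s (s≤s z≤n)))
        ... | true  = arc≡ (s≤s z≤n) i≤ refl p
      -- The path carries a linear order, up to reversal, and the single outside vertex takes the
      -- last label `suc K`, which is `2 * suc m`.
      ... | yes (z , out) = record
        { kind = kindW ; m = suc m ; 1≤m = s≤s z≤n ; sign = base ; v = snoc
        ; injective = λ i≤ j≤ → snoc-injective (bound i≤) (bound j≤)
        ; surjective = surjective ; arcs = λ i<j j≤ → arcs i<j j≤ }
        where
        open Snoc v injective (λ i≤ → out i≤ ∘ sym)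
        size : suc K ≡ 2 * suc m
        size = cong suc (trans e (sym (ℕ.+-suc m (m + 0))))
        bound : ∀ {i} → i ≤ 2 * suc m → i ≤ suc K
        bound {i} = subst (i ≤_) (sym size)
        surjective : ∀ y → ∃[ i ] (i ≤ 2 * suc m × snoc i ≡ y)
        surjective y with locate y
        ... | inj₁ (i , i≤ , e′) = i , subst (i ≤_) size (ℕ.m≤n⇒m≤1+n i≤) , trans (snoc-old i≤) e′
        ... | inj₂ out′ = suc K , ℕ.≤-reflexive size , trans snoc-last (unique out out′)
        2≤ : 2 ≤ K
        2≤ = s≤s (s≤s z≤n)
        3≤ : 3 ≤ K
        3≤ = s≤s (s≤s (s≤s z≤n))
        odd≡ : odd ≡ base
        odd≡ = trans (first (v 3) (v 2) (distinct 3≤ z≤n (λ ()) , distinct 3≤ 1≤ λ ())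
                                        (distinct 2≤ z≤n (λ ()) , distinct 2≤ 1≤ λ ()))
                     (arc≡ (s≤s (s≤s z≤n)) 2≤ refl refl)
        monochrome : ∀ p q → colour p q ≡ base
        monochrome false false = even≡ (s≤s (s≤s z≤n))
        monochrome false true  = refl
        monochrome true  false = refl
        monochrome true  true  = odd≡
        to-z : ∀ i → i ≤ K → arc (v i) z ≡ signed base (parity i)
        to-z i i≤ with parity i in p
        ... | false = trans (outside-even out i≤ p)
          (trans (last z (v 0) (out ℕ.≤-refl , out k≤) (distinct z≤n ℕ.≤-refl (λ ()) , distinct z≤n k≤ λ ()))
          (trans (arc≡ᵒ (s≤s z≤n) k≤ refl even-k) (cong not (even≡ (s≤s (s≤s z≤n))))))
        ... | true = trans (outside-odd out i≤ p)
          (trans (first z (v 2) (out z≤n , out 1≤) (distinct 2≤ z≤n (λ ()) , distinct 2≤ 1≤ λ ()))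
                 (arc≡ (s≤s (s≤s z≤n)) 2≤ refl refl))
        arcs : ∀ {i j} → i < j → j ≤ 2 * suc m →
               arc (snoc i) (snoc j) ≡ signed base (pattern-arc kindW (suc m) i j)
        arcs {i} {j} i<j j≤ with old-or-last (bound j≤)
        ... | inj₁ j≤K = trans (cong₂ arc (snoc-old (ℕ.<⇒≤ (ℕ.<-≤-trans i<j j≤K))) (snoc-old j≤K))
          (trans (trans (formula i j i<j j≤K) (monochrome (parity i) (parity j)))
                 (cong (signed base) (sym (pattern-arcW-inner (suc m) i λ e′ →
                   ℕ.1+n≰n (subst (_≤ K) (trans e′ (sym size)) j≤K)))))
        ... | inj₂ refl = trans (cong₂ arc (snoc-old (ℕ.≤-pred i<j)) snoc-last)
          (trans (to-z i (ℕ.≤-pred i<j)) (cong (signed base) (sym (pattern-arcW-last (suc m) i size))))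

    labelling : ∀ {x y} → I x y → Labelling
    labelling Ixy with shape crit Ixy
    ... | path k w first last = path-label k w first last
    ... | cycle k w closing = cycle-label k w closing

-- Three-element subsets.

rotate-⊎ : ∀ {A B C : Set} → A ⊎ B ⊎ C → B ⊎ C ⊎ A
rotate-⊎ (inj₁ a)       = inj₂ (inj₂ a)
rotate-⊎ (inj₂ (inj₁ b)) = inj₁ b
rotate-⊎ (inj₂ (inj₂ c)) = inj₂ (inj₁ c)

triple : ∀ {n} → Fin n → Fin n → Fin n → Subset n
triple a b c = ⁅ a ⁆ ∪ ⁅ b ⁆ ∪ ⁅ c ⁆

∣⁅x⁆∪p∣ : ∀ {n} {x : Fin n} {p} → x ∉ p → ∣ ⁅ x ⁆ ∪ p ∣ ≡ suc ∣ p ∣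
∣⁅x⁆∪p∣ {x = zero}  {true  ∷ p} x∉ = contradiction here x∉
∣⁅x⁆∪p∣ {x = zero}  {false ∷ p} x∉ = cong (suc ∘ ∣_∣) (Sub.∪-identityˡ p)
∣⁅x⁆∪p∣ {x = suc x} {true  ∷ p} x∉ = cong suc (∣⁅x⁆∪p∣ (x∉ ∘ there))
∣⁅x⁆∪p∣ {x = suc x} {false ∷ p} x∉ = ∣⁅x⁆∪p∣ (x∉ ∘ there)

∈-─⇒∉ : ∀ {n} {x : Fin n} {p q} → x ∈ p ─ q → x ∉ q
∈-─⇒∉ {p = _ ∷ p} {_ ∷ q} (there x∈) (there x∈q) = ∈-─⇒∉ {p = p} {q} x∈ x∈q
∈-─⇒∉ {p = true  ∷ p} {true ∷ q} () here
∈-─⇒∉ {p = false ∷ p} {true ∷ q} () here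

module _ {n : ℕ} where

  private variable
    a b c x y : Fin n
    p q : Subset n

  subset-ext : (∀ {x} → x ∈ p → x ∈ q) → (∀ {x} → x ∈ q → x ∈ p) → p ≡ q
  subset-ext p⊆q q⊆p = Sub.⊆-antisym p⊆q q⊆p

  ∈-triple⁻ : x ∈ triple a b c → x ≡ a ⊎ x ≡ b ⊎ x ≡ c
  ∈-triple⁻ {a = a} {b} {c} x∈ with Sub.x∈p∪q⁻ ⁅ a ⁆ _ x∈
  ... | inj₁ x∈a = inj₁ (Sub.x∈⁅y⁆⇒x≡y a x∈a)
  ... | inj₂ x∈bc with Sub.x∈p∪q⁻ ⁅ b ⁆ ⁅ c ⁆ x∈bc
  ...   | inj₁ x∈b = inj₂ (inj₁ (Sub.x∈⁅y⁆⇒x≡y b x∈b))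
  ...   | inj₂ x∈c = inj₂ (inj₂ (Sub.x∈⁅y⁆⇒x≡y c x∈c))

  ∈-triple⁺ : x ≡ a ⊎ x ≡ b ⊎ x ≡ c → x ∈ triple a b c
  ∈-triple⁺ (inj₁ refl)        = Sub.x∈p∪q⁺ (inj₁ (Sub.x∈⁅x⁆ _))
  ∈-triple⁺ (inj₂ (inj₁ refl)) = Sub.x∈p∪q⁺ (inj₂ (Sub.x∈p∪q⁺ (inj₁ (Sub.x∈⁅x⁆ _))))
  ∈-triple⁺ (inj₂ (inj₂ refl)) = Sub.x∈p∪q⁺ (inj₂ (Sub.x∈p∪q⁺ (inj₂ (Sub.x∈⁅x⁆ _))))

  triple-rotate : triple a b c ≡ triple b c a
  triple-rotate = subset-ext (∈-triple⁺ ∘ rotate-⊎ ∘ ∈-triple⁻) (∈-triple⁺ ∘ rotate-⊎ ∘ rotate-⊎ ∘ ∈-triple⁻)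

  triple-flip : triple a b c ≡ triple a c b
  triple-flip = subset-ext (∈-triple⁺ ∘ turn ∘ ∈-triple⁻) (∈-triple⁺ ∘ turn ∘ ∈-triple⁻)
    where
    turn : ∀ {A B C : Set} → A ⊎ B ⊎ C → A ⊎ C ⊎ B
    turn (inj₁ a)        = inj₁ a
    turn (inj₂ (inj₁ b)) = inj₂ (inj₂ b)
    turn (inj₂ (inj₂ c)) = inj₂ (inj₁ c)

  ∣triple∣ : a ≢ b → a ≢ c → b ≢ c → ∣ triple a b c ∣ ≡ 3
  ∣triple∣ {a} {b} {c} a≢b a≢c b≢c = trans (∣⁅x⁆∪p∣ a∉)
    (cong suc (trans (∣⁅x⁆∪p∣ (Sub.x≢y⇒x∉⁅y⁆ b≢c)) (cong suc (Sub.∣⁅x⁆∣≡1 c))))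
    where
    a∉ : a ∉ ⁅ b ⁆ ∪ ⁅ c ⁆
    a∉ a∈ with Sub.x∈p∪q⁻ ⁅ b ⁆ ⁅ c ⁆ a∈
    ... | inj₁ a∈b = a≢b (Sub.x∈⁅y⁆⇒x≡y b a∈b)
    ... | inj₂ a∈c = a≢c (Sub.x∈⁅y⁆⇒x≡y c a∈c)

  exchange-triple : a ≢ b → a ≢ c → triple x b c ≡ (triple a b c ─ ⁅ a ⁆) ∪ ⁅ x ⁆
  exchange-triple {a} {b} {c} {x} a≢b a≢c = subset-ext forth back
    where
    forth : ∀ {y} → y ∈ triple x b c → y ∈ (triple a b c ─ ⁅ a ⁆) ∪ ⁅ x ⁆
    forth y∈ with ∈-triple⁻ y∈
    ... | inj₁ refl = Sub.x∈p∪q⁺ (inj₂ (Sub.x∈⁅x⁆ _))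
    ... | inj₂ (inj₁ refl) = Sub.x∈p∪q⁺ (inj₁ (Sub.x∈p∧x∉q⇒x∈p─q
            (∈-triple⁺ (inj₂ (inj₁ refl))) (Sub.x≢y⇒x∉⁅y⁆ (a≢b ∘ sym))))
    ... | inj₂ (inj₂ refl) = Sub.x∈p∪q⁺ (inj₁ (Sub.x∈p∧x∉q⇒x∈p─q
            (∈-triple⁺ (inj₂ (inj₂ refl))) (Sub.x≢y⇒x∉⁅y⁆ (a≢c ∘ sym))))
    back : ∀ {y} → y ∈ (triple a b c ─ ⁅ a ⁆) ∪ ⁅ x ⁆ → y ∈ triple x b c
    back y∈ with Sub.x∈p∪q⁻ (triple a b c ─ ⁅ a ⁆) ⁅ x ⁆ y∈
    ... | inj₂ y∈x = ∈-triple⁺ (inj₁ (Sub.x∈⁅y⁆⇒x≡y x y∈x))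
    ... | inj₁ y∈ with ∈-triple⁻ (Sub.p─q⊆p (triple a b c) ⁅ a ⁆ y∈)
    ...   | inj₁ refl = contradiction (Sub.x∈⁅x⁆ _) (∈-─⇒∉ {p = triple a b c} y∈)
    ...   | inj₂ y≡ = ∈-triple⁺ (inj₂ y≡)

-- Boolean arcs and the edges of `C₃`.

module _ {n} (T : Tournament n) where
  open Tournament T

  arcOf : Fin n → Fin n → Bool
  arcOf x y = does (tri⇒dec< compare x y)

  arcOf⇒⟶ : ∀ {x y} → arcOf x y ≡ true → x ⟶ y
  arcOf⇒⟶ {x} {y} e with compare x y
  ... | tri< xy _ _ = xy
  ... | tri≈ _ _ _ = contradiction e λ ()
  ... | tri> _ _ _ = contradiction e λ ()

  ⟶⇒arcOf : ∀ {x y} → x ⟶ y → arcOf x y ≡ true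
  ⟶⇒arcOf {x} {y} = dec-true (tri⇒dec< compare x y)

  ⟶⇒≢ : ∀ {x y} → x ⟶ y → x ≢ y
  ⟶⇒≢ {x} {y} xy with compare x y
  ... | tri< _ x≢y _ = x≢y
  ... | tri≈ ¬xy _ _ = contradiction xy ¬xy
  ... | tri> ¬xy _ _ = contradiction xy ¬xy

  arcOf-anti : ∀ {x y} → x ≢ y → arcOf y x ≡ not (arcOf x y)
  arcOf-anti {x} {y} x≢y with compare x y | compare y x
  ... | tri≈ _ x≡y _ | _ = contradiction x≡y x≢y
  ... | _ | tri≈ _ y≡x _ = contradiction (sym y≡x) x≢y
  ... | tri< xy _ _ | tri< _ _ ¬xy = contradiction xy ¬xy
  ... | tri< _ _ _ | tri> _ _ _ = refl
  ... | tri> _ _ _ | tri< _ _ _ = refl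
  ... | tri> _ _ yx | tri> ¬yx _ _ = contradiction yx ¬yx

module Realization {n} (T : Tournament n) where
  open Tournament T
  open Primality (arcOf T) (arcOf-anti T) public
  open Growth (arcOf T) (arcOf-anti T) public
  open CyclicTriples (arcOf T) (arcOf-anti T) public

  private variable
    a b c : Fin n

  Cyc-rotate : Cyc a b c → Cyc b c a
  Cyc-rotate (e , f) = f , trans (sym f) (sym e)

  Cyc-flip : a ≢ b → a ≢ c → b ≢ c → Cyc a b c → Cyc a c b
  Cyc-flip a≢b a≢c b≢c (e , f) =
    flip-arcs (a≢c ∘ sym) b≢c (sym f) , flip-arcs b≢c a≢b (sym e)

  -- `Cyc` ignores the orientation while `Is3Cycle` fixes it; if `b` dominates `a`, the cycle is
  -- listed as `a`, `c`, `b`.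
  edge⁺ : a ≢ b → a ≢ c → b ≢ c → Cyc a b c → E (C₃ T) (triple a b c)
  edge⁺ {a} {b} {c} a≢b a≢c b≢c cyc@(e , f) = ∣triple∣ a≢b a≢c b≢c , cycle
    where
    cycle : Is3Cycle T (triple a b c)
    cycle with arcOf T a b in ab
    ... | true = a , b , c , refl , arcOf⇒⟶ T ab , arcOf⇒⟶ T (sym e) ,
                 arcOf⇒⟶ T (trans (sym f) (sym e))
    ... | false with Cyc-flip a≢b a≢c b≢c (trans ab e , f)
    ...   | e′ , f′ = a , c , b , triple-flip , arcOf⇒⟶ T (trans e′ (trans f′ ba)) ,
                      arcOf⇒⟶ T (trans f′ ba) , arcOf⇒⟶ T ba
      where
      ba : arcOf T b a ≡ true
      ba = trans (arcOf-anti T a≢b) (cong not ab)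

  edge⁻ : ∀ {e} → E (C₃ T) e → ∃[ a ] ∃[ b ] ∃[ c ]
          (e ≡ triple a b c × a ≢ b × a ≢ c × b ≢ c × Cyc a b c)
  edge⁻ (_ , a , b , c , e≡ , ab , bc , ca) =
    a , b , c , e≡ , ⟶⇒≢ T ab , ⟶⇒≢ T ca ∘ sym , ⟶⇒≢ T bc ,
    trans (⟶⇒arcOf T ab) (sym (⟶⇒arcOf T bc)) , trans (⟶⇒arcOf T bc) (sym (⟶⇒arcOf T ca))

  -- The witness of an edge may list the vertices in any of six orders; rotations settle three, and
  -- a flip followed by rotations the others.
  edge⇒Cyc : a ≢ b → a ≢ c → b ≢ c → E (C₃ T) (triple a b c) → Cyc a b c
  edge⇒Cyc {a} {b} {c} a≢b a≢c b≢c E with edge⁻ E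
  ... | a′ , b′ , c′ , e≡ , a≢b′ , a≢c′ , b≢c′ , cyc = go (mem (inj₁ refl)) (mem (inj₂ (inj₁ refl))) (mem (inj₂ (inj₂ refl)))
    where
    mem : ∀ {x} → x ≡ a ⊎ x ≡ b ⊎ x ≡ c → x ≡ a′ ⊎ x ≡ b′ ⊎ x ≡ c′
    mem = ∈-triple⁻ ∘ subst (_ ∈_) e≡ ∘ ∈-triple⁺
    go : a ≡ a′ ⊎ a ≡ b′ ⊎ a ≡ c′ → b ≡ a′ ⊎ b ≡ b′ ⊎ b ≡ c′ → c ≡ a′ ⊎ c ≡ b′ ⊎ c ≡ c′ → Cyc a b c
    go (inj₁ refl) (inj₁ refl) _ = contradiction refl a≢b
    go (inj₁ refl) _ (inj₁ refl) = contradiction refl a≢c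
    go (inj₂ (inj₁ refl)) (inj₂ (inj₁ refl)) _ = contradiction refl a≢b
    go (inj₂ (inj₁ refl)) _ (inj₂ (inj₁ refl)) = contradiction refl a≢c
    go (inj₂ (inj₂ refl)) (inj₂ (inj₂ refl)) _ = contradiction refl a≢b
    go (inj₂ (inj₂ refl)) _ (inj₂ (inj₂ refl)) = contradiction refl a≢c
    go _ (inj₁ refl) (inj₁ refl) = contradiction refl b≢c
    go _ (inj₂ (inj₁ refl)) (inj₂ (inj₁ refl)) = contradiction refl b≢c
    go _ (inj₂ (inj₂ refl)) (inj₂ (inj₂ refl)) = contradiction refl b≢c
    go (inj₁ refl) (inj₂ (inj₁ refl)) (inj₂ (inj₂ refl)) = cyc
    go (inj₂ (inj₁ refl)) (inj₂ (inj₂ refl)) (inj₁ refl) = Cyc-rotate cyc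
    go (inj₂ (inj₂ refl)) (inj₁ refl) (inj₂ (inj₁ refl)) = Cyc-rotate (Cyc-rotate cyc)
    go (inj₁ refl) (inj₂ (inj₂ refl)) (inj₂ (inj₁ refl)) = Cyc-flip a≢b′ a≢c′ b≢c′ cyc
    go (inj₂ (inj₁ refl)) (inj₁ refl) (inj₂ (inj₂ refl)) = Cyc-rotate (Cyc-rotate (Cyc-flip a≢b′ a≢c′ b≢c′ cyc))
    go (inj₂ (inj₂ refl)) (inj₂ (inj₁ refl)) (inj₁ refl) = Cyc-rotate (Cyc-flip a≢b′ a≢c′ b≢c′ cyc)

  Cyc-irreflexive : a ≢ b → ¬ Cyc a b b
  Cyc-irreflexive a≢b (e , f) = 𝔹.not-¬ refl (trans (trans e f) (arcOf-anti T a≢b))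

-- Isomorphisms up to reversal and their effect on `C₃`.

module _ {m n} (π : Permutation m n) where

  private variable
    e : Subset m

  ∈-image⁺ : ∀ {j} → (π ⟨$⟩ˡ j) ∈ e → j ∈ image π e
  ∈-image⁺ {j = j} p = lookup⇒[]= j _ (trans (lookup∘tabulate _ j) ([]=⇒lookup p))

  ∈-image⁻ : ∀ {j} → j ∈ image π e → (π ⟨$⟩ˡ j) ∈ e
  ∈-image⁻ {e} {j} p = lookup⇒[]= _ e (trans (sym (lookup∘tabulate _ j)) ([]=⇒lookup p))

  image-triple : ∀ a b c → image π (triple a b c) ≡ triple (π ⟨$⟩ʳ a) (π ⟨$⟩ʳ b) (π ⟨$⟩ʳ c)
  image-triple a b c = subset-ext
    (∈-triple⁺ ∘ forth ∘ ∈-triple⁻ ∘ ∈-image⁻) (∈-image⁺ ∘ ∈-triple⁺ ∘ back ∘ ∈-triple⁻)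
    where
    to : ∀ {x y} → π ⟨$⟩ˡ x ≡ y → x ≡ π ⟨$⟩ʳ y
    to refl = sym (inverseʳ π)
    from : ∀ {x y} → x ≡ π ⟨$⟩ʳ y → π ⟨$⟩ˡ x ≡ y
    from refl = inverseˡ π
    forth : ∀ {x} → π ⟨$⟩ˡ x ≡ a ⊎ π ⟨$⟩ˡ x ≡ b ⊎ π ⟨$⟩ˡ x ≡ c → x ≡ π ⟨$⟩ʳ a ⊎ x ≡ π ⟨$⟩ʳ b ⊎ x ≡ π ⟨$⟩ʳ c
    forth = [ inj₁ ∘ to , [ inj₂ ∘ inj₁ ∘ to , inj₂ ∘ inj₂ ∘ to ] ]
    back : ∀ {x} → x ≡ π ⟨$⟩ʳ a ⊎ x ≡ π ⟨$⟩ʳ b ⊎ x ≡ π ⟨$⟩ʳ c → π ⟨$⟩ˡ x ≡ a ⊎ π ⟨$⟩ˡ x ≡ b ⊎ π ⟨$⟩ˡ x ≡ c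
    back = [ inj₁ ∘ from , [ inj₂ ∘ inj₁ ∘ from , inj₂ ∘ inj₂ ∘ from ] ]

image-inverse : ∀ {m n} (π : Permutation m n) e → image (inverse π) (image π e) ≡ e
image-inverse π e = subset-ext
  (λ p → subst (_∈ e) (inverseˡ π) (∈-image⁻ π (∈-image⁻ (inverse π) p)))
  (λ p → ∈-image⁺ (inverse π) (∈-image⁺ π (subst (_∈ e) (sym (inverseˡ π)) p)))

signed-involutive : ∀ s p → signed s (signed s p) ≡ p
signed-involutive true  true  = refl
signed-involutive true  false = refl
signed-involutive false true  = refl
signed-involutive false false = refl

signed-injective : ∀ s {p q} → signed s p ≡ signed s q → p ≡ q
signed-injective s e = trans (sym (signed-involutive s _)) (trans (cong (signed s) e) (signed-involutive s _))

signed-not : ∀ s p → signed s (not p) ≡ not (signed s p)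
signed-not s true  = refl
signed-not s false = sym (𝔹.not-involutive s)

SignedIso : ∀ {m n} → Permutation m n → Bool → Tournament m → Tournament n → Set
SignedIso π s T T′ = ∀ {x y} → x ≢ y → arcOf T x y ≡ signed s (arcOf T′ (π ⟨$⟩ʳ x) (π ⟨$⟩ʳ y))

module _ {m n} (π : Permutation m n) (s : Bool) (T : Tournament m) (T′ : Tournament n) where

  -- `Cyc` only compares arcs with each other, so a common sign cancels.
  C₃-image : SignedIso π s T T′ → ∀ {e} → E (C₃ T) e → E (C₃ T′) (image π e)
  C₃-image iso Ee with Realization.edge⁻ T Ee
  ... | a , b , c , refl , a≢b , a≢c , b≢c , p , q = subst (E (C₃ T′)) (sym (image-triple π a b c))
    (Realization.edge⁺ T′ (a≢b ∘ inj) (a≢c ∘ inj) (b≢c ∘ inj)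
      ( signed-injective s (trans (sym (iso a≢b)) (trans p (iso b≢c)))
      , signed-injective s (trans (sym (iso b≢c)) (trans q (iso (a≢c ∘ sym))))))
    where
    inj : ∀ {x y} → π ⟨$⟩ʳ x ≡ π ⟨$⟩ʳ y → x ≡ y
    inj e = trans (sym (inverseˡ π)) (trans (cong (π ⟨$⟩ˡ_) e) (inverseˡ π))

C₃-iso : ∀ {m n} (π : Permutation m n) s T T′ → SignedIso π s T T′ →
         ∀ e → E (C₃ T) e ⇔ E (C₃ T′) (image π e)
C₃-iso π s T T′ iso e = mk⇔ (C₃-image π s T T′ iso) λ E′ →
  subst (E (C₃ T)) (image-inverse π e) (C₃-image (inverse π) s T′ T iso′ E′)
  where
  iso′ : SignedIso (inverse π) s T′ T
  iso′ {x} {y} x≢y = trans (sym (signed-involutive s _)) (cong (signed s) (trans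
    (cong₂ (λ x y → signed s (arcOf T′ x y)) (sym (inverseʳ π)) (sym (inverseʳ π)))
    (sym (iso λ e → x≢y (trans (sym (inverseʳ π)) (trans (cong (π ⟨$⟩ʳ_) e) (inverseʳ π)))))))

-- Modules of a hypergraph and modules of its realization.

module _ {n} {H : Hypergraph n} {T : Tournament n} (realizes : Realizes T H) where
  open Realization T

  private
    to-Cyc : ∀ {e} → E H e → E (C₃ T) e
    to-Cyc = Equivalence.to (realizes _)

  NontrivialModule⇒decomposable : NontrivialModule Full → Decomposable H
  NontrivialModule⇒decomposable N = S , isModule , nontrivial
    where
    open NontrivialModule N
    S : Subset n
    S = subset M?
    in⁺ : ∀ {z} → M z → z ∈ S
    in⁺ = ∈-subset⁺ M?
    in⁻ : ∀ {z} → z ∈ S → M z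
    in⁻ = ∈-subset⁻ M?

    nontrivial : ¬ Trivial S
    nontrivial (inj₁ S≡⊥) = Sub.∉⊥ (subst (_ ∈_) S≡⊥ (in⁺ Ma))
    nontrivial (inj₂ (inj₁ S≡⊤)) = ¬Mc (in⁻ (subst (_ ∈_) (sym S≡⊤) Sub.∈⊤))
    nontrivial (inj₂ (inj₂ (v , S≡v))) = a≢b (trans (only Ma) (sym (only Mb)))
      where
      only : ∀ {z} → M z → z ≡ v
      only Mz = Sub.x∈⁅y⁆⇒x≡y v (subst (_ ∈_) S≡v (in⁺ Mz))

    Goal : Subset n → Set
    Goal e = ∃[ m ] (m ∈ S × e ∩ S ≡ ⁅ m ⁆ × (∀ k → k ∈ S → E H ((e ─ ⁅ m ⁆) ∪ ⁅ k ⁆)))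

    -- Neither `b` nor `c` distinguishes vertices of `M`, so the cycle survives replacing `a` by any
    -- of them.
    one-in : ∀ {a b c} → a ≢ b → a ≢ c → b ≢ c → Cyc a b c → M a → ¬ M b → ¬ M c → Goal (triple a b c)
    one-in {a} {b} {c} a≢b a≢c b≢c (e , f) Ma ¬Mb ¬Mc = a , in⁺ Ma , subset-ext meet⁻ meet⁺ , exchange
      where
      meet⁻ : ∀ {x} → x ∈ triple a b c ∩ S → x ∈ ⁅ a ⁆
      meet⁻ x∈ with Sub.x∈p∩q⁻ (triple a b c) S x∈
      ... | x∈t , x∈S with ∈-triple⁻ x∈t
      ...   | inj₁ refl = Sub.x∈⁅x⁆ _
      ...   | inj₂ (inj₁ refl) = contradiction (in⁻ x∈S) ¬Mb
      ...   | inj₂ (inj₂ refl) = contradiction (in⁻ x∈S) ¬Mc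
      meet⁺ : ∀ {x} → x ∈ ⁅ a ⁆ → x ∈ triple a b c ∩ S
      meet⁺ x∈ with Sub.x∈⁅y⁆⇒x≡y a x∈
      ... | refl = Sub.x∈p∩q⁺ (∈-triple⁺ (inj₁ refl) , in⁺ Ma)
      exchange : ∀ k → k ∈ S → E H ((triple a b c ─ ⁅ a ⁆) ∪ ⁅ k ⁆)
      exchange k k∈S = subst (E H) (exchange-triple a≢b a≢c) (Equivalence.from (realizes _)
        (edge⁺ k≢b k≢c b≢c
          ( trans (flip-arcs (k≢b ∘ sym) (a≢b ∘ sym) (const tt ¬Mb tt (in⁻ k∈S) tt Ma)) e
          , trans f (const tt ¬Mc tt Ma tt (in⁻ k∈S)))))
        where
        k≢b : k ≢ b
        k≢b refl = ¬Mb (in⁻ k∈S)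
        k≢c : k ≢ c
        k≢c refl = ¬Mc (in⁻ k∈S)

    -- On a 3-cycle `c` dominates exactly one of `a` and `b`, so if outside the module it would
    -- distinguish them.
    two-in : ∀ {a b c} → b ≢ c → Cyc a b c → M a → M b → ¬ ¬ M c
    two-in b≢c (e , f) Ma Mb ¬Mc =
      𝔹.not-¬ refl (trans (trans (const tt ¬Mc tt Mb tt Ma) (sym f)) (arcOf-anti T (b≢c ∘ sym)))

    isModule : IsModule H S
    isModule e Ee (x , x∈) (y , y∈) with edge⁻ (to-Cyc Ee)
    ... | a , b , c , refl , a≢b , a≢c , b≢c , cyc with M? a | M? b | M? c
    ... | yes Ma | yes Mb | yes Mc = contradiction (in⁺ My) (∈-─⇒∉ {p = triple a b c} y∈)
      where
      My : M y
      My with ∈-triple⁻ (Sub.p─q⊆p (triple a b c) S y∈)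
      ... | inj₁ refl = Ma
      ... | inj₂ (inj₁ refl) = Mb
      ... | inj₂ (inj₂ refl) = Mc
    ... | no ¬Ma | no ¬Mb | no ¬Mc = ⊥-elim disjoint
      where
      disjoint : ⊥
      disjoint with Sub.x∈p∩q⁻ (triple a b c) S x∈
      ... | x∈t , x∈S with ∈-triple⁻ x∈t
      ...   | inj₁ refl = ¬Ma (in⁻ x∈S)
      ...   | inj₂ (inj₁ refl) = ¬Mb (in⁻ x∈S)
      ...   | inj₂ (inj₂ refl) = ¬Mc (in⁻ x∈S)
    ... | yes Ma | no ¬Mb | no ¬Mc = one-in a≢b a≢c b≢c cyc Ma ¬Mb ¬Mc
    ... | no ¬Ma | yes Mb | no ¬Mc = subst Goal (sym triple-rotate)
      (one-in b≢c (a≢b ∘ sym) (a≢c ∘ sym) (Cyc-rotate cyc) Mb ¬Mc ¬Ma)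
    ... | no ¬Ma | no ¬Mb | yes Mc = subst Goal triple-rotate
      (one-in (a≢c ∘ sym) (b≢c ∘ sym) a≢b (Cyc-rotate (Cyc-rotate cyc)) Mc ¬Ma ¬Mb)
    ... | yes Ma | yes Mb | no ¬Mc = contradiction ¬Mc (two-in b≢c cyc Ma Mb)
    ... | no ¬Ma | yes Mb | yes Mc = contradiction ¬Ma (two-in (a≢c ∘ sym) (Cyc-rotate cyc) Mb Mc)
    ... | yes Ma | no ¬Mb | yes Mc = contradiction ¬Mb (two-in a≢b (Cyc-rotate (Cyc-rotate cyc)) Mc Ma)

nontrivial⇒ : ∀ {n} (M : Subset n) → ¬ Trivial M → ∃[ a ] ∃[ b ] ∃[ c ] (a ∈ M × b ∈ M × c ∉ M × a ≢ b)
nontrivial⇒ M nt with any? (_∈? M)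
... | no ¬a = contradiction (inj₁ (Sub.Empty-unique ¬a)) nt
... | yes (a , a∈) with any? (λ c → ¬? (c ∈? M)) | any? (λ b → (b ∈? M) ×-dec ¬? (a ≟ b))
...   | no ¬c | _ = contradiction (inj₂ (inj₁ (subset-ext (λ _ → Sub.∈⊤)
          λ {x} _ → decidable-stable (x ∈? M) λ x∉ → ¬c (x , x∉)))) nt
...   | yes _ | no ¬b = contradiction (inj₂ (inj₂ (a , subset-ext
          (λ {x} x∈ → subst (_∈ ⁅ a ⁆) (decidable-stable (a ≟ x) λ a≢x → ¬b (x , x∈ , a≢x)) (Sub.x∈⁅x⁆ a))
          λ x∈ → subst (_∈ M) (sym (Sub.x∈⁅y⁆⇒x≡y a x∈)) a∈))) nt
...   | yes (c , c∉) | yes (b , b∈ , a≢b) = a , b , c , a∈ , b∈ , c∉ , a≢b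

module _ {n} (v : Fin (suc n)) where

  ∈-insertAt⁺ : ∀ {M : Subset n} {i} → i ∈ M → punchIn v i ∈ insertAt M v outside
  ∈-insertAt⁺ {M} {i} i∈ = lookup⇒[]= _ _ (trans (insertAt-punchIn M v outside i) ([]=⇒lookup i∈))

  ∈-insertAt⁻ : ∀ {M : Subset n} {i} → punchIn v i ∈ insertAt M v outside → i ∈ M
  ∈-insertAt⁻ {M} {i} i∈ = lookup⇒[]= _ _ (trans (sym (insertAt-punchIn M v outside i)) ([]=⇒lookup i∈))

  data Punched : Fin (suc n) → Set where
    at   : Punched v
    from : ∀ i → Punched (punchIn v i)

  punched : ∀ x → Punched x
  punched x with v ≟ x
  ... | yes refl = at
  ... | no v≢x = subst Punched (punchIn-punchOut v≢x) (from (punchOut v≢x))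

  ∉-insertAt : ∀ {M : Subset n} → v ∉ insertAt M v outside
  ∉-insertAt {M} v∈ = contradiction (trans (sym (insertAt-lookup M v outside)) ([]=⇒lookup v∈)) λ ()

  insertAt-triple : ∀ a b c → insertAt (triple a b c) v outside ≡ triple (punchIn v a) (punchIn v b) (punchIn v c)
  insertAt-triple a b c = subset-ext (λ {x} → forth x) back
    where
    forth : ∀ x → x ∈ insertAt (triple a b c) v outside → x ∈ triple (punchIn v a) (punchIn v b) (punchIn v c)
    forth x x∈ with punched x
    ... | at = contradiction x∈ (∉-insertAt {triple a b c})
    ... | from i with ∈-triple⁻ (∈-insertAt⁻ {triple a b c} x∈)
    ...   | inj₁ refl = ∈-triple⁺ (inj₁ refl)
    ...   | inj₂ (inj₁ refl) = ∈-triple⁺ (inj₂ (inj₁ refl))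
    ...   | inj₂ (inj₂ refl) = ∈-triple⁺ (inj₂ (inj₂ refl))
    back : ∀ {x} → x ∈ triple (punchIn v a) (punchIn v b) (punchIn v c) → x ∈ insertAt (triple a b c) v outside
    back x∈ with ∈-triple⁻ x∈
    ... | inj₁ refl = ∈-insertAt⁺ (∈-triple⁺ (inj₁ refl))
    ... | inj₂ (inj₁ refl) = ∈-insertAt⁺ (∈-triple⁺ (inj₂ (inj₁ refl)))
    ... | inj₂ (inj₂ refl) = ∈-insertAt⁺ (∈-triple⁺ (inj₂ (inj₂ refl)))

module _ {n} {H : Hypergraph (suc n)} {T : Tournament (suc n)} (realizes : Realizes T H) where
  open Realization T

  -- The module of `delete H v`, carried into the original vertices, satisfies `no-two` and
  -- `replace` on `Off v`.
  decomposable⇒NontrivialModule : ∀ v → Decomposable (delete H v) → NontrivialModule (Off v)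
  decomposable⇒NontrivialModule v (S , isModule , nt) with nontrivial⇒ S nt
  ... | a₀ , b₀ , c₀ , a₀∈ , b₀∈ , c₀∉ , a₀≢b₀ =
    cyclicModule⇒NontrivialModule (Off? v) (_∈? M) no-two replace (punchInᵢ≢i v a₀) (∈-insertAt⁺ v a₀∈)
      (punchInᵢ≢i v b₀) (∈-insertAt⁺ v b₀∈) (punchInᵢ≢i v c₀) (c₀∉ ∘ ∈-insertAt⁻ v)
      (a₀≢b₀ ∘ punchIn-injective v _ _)
    where
    M : Subset (suc n)
    M = insertAt S v outside
    ι : Fin n → Fin (suc n)
    ι = punchIn v

    edge : ∀ {a b c} → ι a ≢ ι b → ι a ≢ ι c → ι b ≢ ι c → Cyc (ι a) (ι b) (ι c) → E (delete H v) (triple a b c)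
    edge {a} {b} {c} a≢b a≢c b≢c cyc = Equivalence.from (realizes _)
      (subst (E (C₃ T)) (sym (insertAt-triple v a b c)) (edge⁺ a≢b a≢c b≢c cyc))

    inner : ∀ {x} → Off v x → Σ (Fin n) λ i → ι i ≡ x
    inner {x} x≢v with punched v x
    ... | at = contradiction refl x≢v
    ... | from i = i , refl

    meets : ∀ {a b c d} → d ∈ triple a b c → d ∈ S → Nonempty (triple a b c ∩ S)
    meets {d = d} d∈t d∈S = d , Sub.x∈p∩q⁺ (d∈t , d∈S)

    leaves : ∀ {a b c d} → d ∈ triple a b c → d ∉ S → Nonempty (triple a b c ─ S)
    leaves {d = d} d∈t d∉S = d , Sub.x∈p∧x∉q⇒x∈p─q d∈t d∉S

    no-two : ∀ {a b x} → Off v a → a ∈ M → Off v b → b ∈ M → Off v x → x ∉ M → a ≢ b → ¬ Cyc a b x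
    no-two a≢v a∈ b≢v b∈ x≢v x∉ a≢b cyc with inner a≢v | inner b≢v | inner x≢v
    ... | a , refl | b , refl | x , refl
      with isModule _ (edge a≢b (λ e → x∉ (subst (_∈ M) e a∈)) (λ e → x∉ (subst (_∈ M) e b∈)) cyc)
                    (meets {a} {b} {x} (∈-triple⁺ (inj₁ refl)) (∈-insertAt⁻ v a∈))
                    (leaves {a} {b} {x} (∈-triple⁺ (inj₂ (inj₂ refl))) (x∉ ∘ ∈-insertAt⁺ v))
    ... | m , _ , meet , _ = a≢b (cong ι (trans (only (inj₁ refl) a∈) (sym (only (inj₂ (inj₁ refl)) b∈))))
      where
      only : ∀ {d} → d ≡ a ⊎ d ≡ b ⊎ d ≡ x → ι d ∈ M → d ≡ m
      only d∈t d∈M = Sub.x∈⁅y⁆⇒x≡y m (subst (_ ∈_) meet (Sub.x∈p∩q⁺ (∈-triple⁺ d∈t , ∈-insertAt⁻ v d∈M)))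

    apart : ∀ {a x} → a ∈ M → x ∉ M → a ≢ x
    apart a∈ x∉ refl = x∉ a∈

    replace : ∀ {a b x y} → Off v a → a ∈ M → Off v b → b ∈ M → Off v x → x ∉ M → Off v y → y ∉ M →
              Cyc a x y → Cyc b x y
    replace a≢v a∈ b≢v b∈ x≢v x∉ y≢v y∉ cyc with inner a≢v | inner b≢v | inner x≢v | inner y≢v
    ... | a , refl | b , refl | x , refl | y , refl = conclude
      (isModule _ (edge (apart a∈ x∉) (apart a∈ y∉) x≢y cyc)
        (meets {a} {x} {y} (∈-triple⁺ (inj₁ refl)) (∈-insertAt⁻ v a∈))
        (leaves {a} {x} {y} (∈-triple⁺ (inj₂ (inj₂ refl))) (y∉ ∘ ∈-insertAt⁺ v)))
      where
      x≢y : ι x ≢ ι y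
      x≢y e = Cyc-irreflexive (apart a∈ x∉) (subst (Cyc (ι a) (ι x)) (sym e) cyc)
      conclude : ∃[ m ] (m ∈ S × triple a x y ∩ S ≡ ⁅ m ⁆ ×
                   (∀ k → k ∈ S → E (delete H v) ((triple a x y ─ ⁅ m ⁆) ∪ ⁅ k ⁆))) →
                 Cyc (ι b) (ι x) (ι y)
      conclude (m , _ , meet , exchange)
        with Sub.x∈⁅y⁆⇒x≡y m (subst (a ∈_) meet (Sub.x∈p∩q⁺ (∈-triple⁺ (inj₁ refl) , ∈-insertAt⁻ v a∈)))
      ... | refl = edge⇒Cyc (apart b∈ x∉) (apart b∈ y∉) x≢y
        (subst (E (C₃ T)) (insertAt-triple v b x y) (Equivalence.to (realizes _)
          (subst (E (delete H v)) (sym (exchange-triple (apart a∈ x∉ ∘ cong ι) (apart a∈ y∉ ∘ cong ι)))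
            (exchange b (∈-insertAt⁻ v b∈)))))

-- A first edge of the indecomposability graph.

module _ {n} (T : Tournament n) where
  open Realization T

  opposite-arcs-differ : ∀ {a b c} → a ≢ c → Cyc a b c → arcOf T a b ≢ arcOf T a c
  opposite-arcs-differ a≢c (e , f) g = 𝔹.not-¬ refl (trans (sym g) (trans (trans e f) (arcOf-anti T a≢c)))

  cycle-prime : ∀ {a b c} → a ≢ b → a ≢ c → b ≢ c → Cyc a b c → PrimeOn (λ z → z ≡ a ⊎ z ≡ b ⊎ z ≡ c)
  cycle-prime {a} {b} {c} a≢b a≢c b≢c cyc = primeOn
    (three (inj₁ refl) (inj₂ (inj₁ refl)) (inj₂ (inj₂ refl)) a≢b a≢c b≢c) λ N →
      let open NontrivialModule N renaming (a to x; b to y; c to z; a≢b to x≢y)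
          agree = const Xc ¬Mc Xa Ma Xb Mb
          x≢z : x ≢ z
          x≢z = λ { refl → ¬Mc Ma }
          y≢z : y ≢ z
          y≢z = λ { refl → ¬Mc Mb }
      in [ (λ { refl → clash a≢c cyc Xa Xb x≢z y≢z x≢y agree })
         , [ (λ { refl → clash (a≢b ∘ sym) (Cyc-rotate cyc) (rotate-⊎ Xa) (rotate-⊎ Xb) x≢z y≢z x≢y agree })
           , (λ { refl → clash (b≢c ∘ sym) (Cyc-rotate (Cyc-rotate cyc)) (rotate-⊎ (rotate-⊎ Xa)) (rotate-⊎ (rotate-⊎ Xb)) x≢z y≢z x≢y agree })
           ] ] Xc
    where
    clash : ∀ {a b c x y} → a ≢ c → Cyc a b c → x ≡ a ⊎ x ≡ b ⊎ x ≡ c → y ≡ a ⊎ y ≡ b ⊎ y ≡ c →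
            x ≢ a → y ≢ a → x ≢ y → arcOf T a x ≢ arcOf T a y
    clash a≢c cyc (inj₁ x≡a) _ x≢a _ _ _ = x≢a x≡a
    clash a≢c cyc _ (inj₁ y≡a) _ y≢a _ _ = y≢a y≡a
    clash a≢c cyc (inj₂ (inj₁ refl)) (inj₂ (inj₁ refl)) _ _ x≢y _ = x≢y refl
    clash a≢c cyc (inj₂ (inj₂ refl)) (inj₂ (inj₂ refl)) _ _ x≢y _ = x≢y refl
    clash a≢c cyc (inj₂ (inj₁ refl)) (inj₂ (inj₂ refl)) _ _ _ = opposite-arcs-differ a≢c cyc
    clash a≢c cyc (inj₂ (inj₂ refl)) (inj₂ (inj₁ refl)) _ _ _ = opposite-arcs-differ a≢c cyc ∘ sym

  -- Without 3-cycles, any pair of vertices satisfies `no-two` and `replace` vacuously, so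
  -- `cyclicModule⇒NontrivialModule` yields a module of the tournament.
  prime-triple : ¬ NontrivialModule Full → Three Full →
                 ∃[ a ] ∃[ b ] ∃[ c ] (a ≢ b × a ≢ c × b ≢ c × Cyc a b c)
  prime-triple ¬NF t with any? (λ a → any? λ b → any? λ c →
    ¬? (a ≟ b) ×-dec ¬? (a ≟ c) ×-dec ¬? (b ≟ c) ×-dec
    (arcOf T a b 𝔹.≟ arcOf T b c) ×-dec (arcOf T b c 𝔹.≟ arcOf T c a))
  ... | yes found = found
  ... | no acyclic = contradiction
    (cyclicModule⇒NontrivialModule {M = λ z → z ≡ p ⊎ z ≡ q} (λ _ → yes tt) (λ z → (z ≟ p) ⊎-dec (z ≟ q))
      (λ _ Ma _ Mb _ ¬Mx a≢b (e , f) → acyclic (_ , _ , _ , a≢b , outer Ma ¬Mx , outer Mb ¬Mx , e , f))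
      (λ _ Ma _ _ _ ¬Mx _ ¬My (e , f) → contradiction
        (_ , _ , _ , outer Ma ¬Mx , outer Ma ¬My ,
          (λ { refl → Cyc-irreflexive (outer Ma ¬Mx) (e , f) }) , e , f) acyclic)
      tt (inj₁ refl) tt (inj₂ refl) tt [ p≢r ∘ sym , q≢r ∘ sym ] p≢q) ¬NF
    where
    open Three t
    outer : ∀ {M : VSet} {a x} → M a → ¬ M x → a ≢ x
    outer Ma ¬Mx refl = ¬Mx Ma

  critical-edge : ¬ NontrivialModule Full → (∀ x → NontrivialModule (Off x)) → Fin n → ∃[ x ] ∃[ y ] (x ≢ y × PrimeOn (Off₂ x y))
  critical-edge ¬NF crit v with prime-triple ¬NF (Three-mono _ (NontrivialModule-size (crit v)))
  -- A nontrivial module of `Off a` needs three vertices there, so one lies off the 3-cycle and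
  -- growth can begin.
  ... | a , b , c , a≢b , a≢c , b≢c , cyc with other (NontrivialModule-size (crit a)) b c
  ...   | z , z≢a , z≢b , z≢c = grow ¬NF crit (λ z → (z ≟ a) ⊎-dec (z ≟ b) ⊎-dec (z ≟ c))
            (cycle-prime a≢b a≢c b≢c cyc) [ z≢a , [ z≢b , z≢c ] ]

-- The arcs of the three families.

module _ {n} {A B : Pred (Fin n) 0ℓ} (A? : Decidable A) (B? : Decidable B) (T : Tournament n) where
  open Tournament T

  reverse-between : ∀ {x y} → x ⟶ y → Between A? B? T x y → arcOf (reverseBetween A? B? T) x y ≡ false
  reverse-between xy b = trans (arcOf-anti (reverseBetween A? B? T) (⟶⇒≢ T xy ∘ sym))
    (cong not (⟶⇒arcOf (reverseBetween A? B? T) (inj₁ (flipped A? B? T b , xy))))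

  keep-arc : ∀ {x y} → x ⟶ y → ¬ Between A? B? T x y → arcOf (reverseBetween A? B? T) x y ≡ true
  keep-arc xy ¬b = ⟶⇒arcOf (reverseBetween A? B? T) (inj₂ (¬b , xy))

parity-even : ∀ {i} → parity i ≡ false → 2 ∣ i
parity-even {i} e with halve i
... | m , inj₁ refl = divides m (ℕ.*-comm 2 m)
... | m , inj₂ refl = contradiction (trans (sym e) (cong not (parity-2* m))) λ ()

parity-odd : ∀ {i} → parity i ≡ true → ¬ 2 ∣ i
parity-odd {i} e (divides m refl) = contradiction
  (trans (sym e) (trans (cong parity (ℕ.*-comm m 2)) (parity-2* m))) λ ()

tournament : Kind → ∀ m → Tournament (suc (2 * m))
tournament kindT = T₂ₙ₊₁
tournament kindU = U₂ₙ₊₁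
tournament kindW = W₂ₙ₊₁

tournament-arc : ∀ kind m {i j} → i Fin.< j →
                 arcOf (tournament kind m) i j ≡ pattern-arc kind m (toℕ i) (toℕ j)
tournament-arc kindT m {i} {j} i<j with parity (toℕ i) in p | parity (toℕ j) in q
... | false | false = keep-arc even? (∁? even?) (L₂ₙ₊₁ m) i<j
  λ { (inj₁ (_ , ¬j)) → ¬j (parity-even q) ; (inj₂ (¬i , _)) → ¬i (parity-even p) }
... | false | true = reverse-between even? (∁? even?) (L₂ₙ₊₁ m) i<j (inj₁ (parity-even p , parity-odd q))
... | true | false = reverse-between even? (∁? even?) (L₂ₙ₊₁ m) i<j (inj₂ (parity-odd p , parity-even q))
... | true | true = keep-arc even? (∁? even?) (L₂ₙ₊₁ m) i<j
  λ { (inj₁ (i , _)) → parity-odd p i ; (inj₂ (_ , j)) → parity-odd q j }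
tournament-arc kindU m {i} {j} i<j with parity (toℕ i) in p | parity (toℕ j) in q
... | false | false = reverse-between even? even? (L₂ₙ₊₁ m) i<j (inj₁ (parity-even p , parity-even q))
... | false | true = keep-arc even? even? (L₂ₙ₊₁ m) i<j [ parity-odd q ∘ proj₂ , parity-odd q ∘ proj₂ ]
... | true | _ = keep-arc even? even? (L₂ₙ₊₁ m) i<j [ parity-odd p ∘ proj₁ , parity-odd p ∘ proj₁ ]
tournament-arc kindW m {i} {j} i<j = by (last? j) (parity (toℕ i)) refl
  where
  last? : Decidable (λ (x : Fin (suc (2 * m))) → toℕ x ≡ 2 * m)
  last? x = toℕ x ℕ.≟ 2 * m
  evenNotLast? : Decidable (λ (x : Fin (suc (2 * m))) → Even x × toℕ x < 2 * m)
  evenNotLast? = even? ∩? (λ x → toℕ x ℕ.<? 2 * m)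
  by : Dec (toℕ j ≡ 2 * m) → ∀ p → parity (toℕ i) ≡ p →
       arcOf (W₂ₙ₊₁ m) i j ≡ pattern-arc kindW m (toℕ i) (toℕ j)
  -- Only the larger index can be `2 * m`, so here neither endpoint is the last vertex.
  by (no j≢) _ _ = trans (keep-arc last? evenNotLast? (L₂ₙ₊₁ m) i<j
    λ { (inj₁ (i≡ , _)) → ℕ.<⇒≱ (subst (_< toℕ j) i≡ i<j) (ℕ.≤-pred (toℕ<n j)) ; (inj₂ (_ , j≡)) → j≢ j≡ })
    (sym (pattern-arcW-inner m (toℕ i) j≢))
  by (yes j≡) false p = trans (reverse-between last? evenNotLast? (L₂ₙ₊₁ m) i<j
    (inj₂ ((parity-even p , subst (toℕ i <_) j≡ i<j) , j≡)))
    (trans (sym p) (sym (pattern-arcW-last m (toℕ i) j≡)))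
  by (yes j≡) true p = trans (keep-arc last? evenNotLast? (L₂ₙ₊₁ m) i<j
    λ { (inj₁ (i≡ , _)) → ℕ.<⇒≢ i<j (trans i≡ (sym j≡)) ; (inj₂ ((i , _) , _)) → parity-odd p i })
    (trans (sym p) (sym (pattern-arcW-last m (toℕ i) j≡)))

-- From labellings to isomorphisms, and the classification.

module _ {n} (T : Tournament n) where
  open Labels (arcOf T) (arcOf-anti T)

  module _ (L : Labelling) where
    open Labelling L

    labelling-permutation : Permutation n (suc (2 * m))
    labelling-permutation = permutation to (v ∘ toℕ) to∘v v∘to
      where
      to : Fin n → Fin (suc (2 * m))
      to z = fromℕ< (s≤s (proj₁ (proj₂ (surjective z))))
      v∘to : ∀ z → v (toℕ (to z)) ≡ z
      v∘to z = trans (cong v (toℕ-fromℕ< _)) (proj₂ (proj₂ (surjective z)))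
      to∘v : ∀ i → to (v (toℕ i)) ≡ i
      to∘v i = toℕ-injective (injective (ℕ.≤-pred (toℕ<n (to (v (toℕ i))))) (ℕ.≤-pred (toℕ<n i)) (v∘to _))

    labelling-iso : SignedIso labelling-permutation sign T (tournament kind m)
    labelling-iso {x} {y} x≢y = subst₂ (λ x′ y′ → arcOf T x′ y′ ≡ signed sign (arcOf T′ (π ⟨$⟩ʳ x) (π ⟨$⟩ʳ y)))
        (inverseˡ π) (inverseˡ π) (main (π ⟨$⟩ʳ x) (π ⟨$⟩ʳ y) λ e → x≢y (trans (sym (inverseˡ π)) (trans (cong (π ⟨$⟩ˡ_) e) (inverseˡ π))))
      where
      π : Permutation n (suc (2 * m))
      π = labelling-permutation
      T′ : Tournament (suc (2 * m))
      T′ = tournament kind m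
      up : ∀ i j → i Fin.< j → arcOf T (v (toℕ i)) (v (toℕ j)) ≡ signed sign (arcOf T′ i j)
      up i j i<j = trans (arcs i<j (ℕ.≤-pred (toℕ<n j))) (cong (signed sign) (sym (tournament-arc kind m i<j)))
      main : ∀ i j → i ≢ j → arcOf T (v (toℕ i)) (v (toℕ j)) ≡ signed sign (arcOf T′ i j)
      main i j i≢j with <-cmp i j
      ... | tri< i<j _ _ = up i j i<j
      ... | tri≈ _ i≡j _ = contradiction i≡j i≢j
      ... | tri> _ _ j<i = trans (arcOf-anti T (λ e → i≢j (sym (toℕ-injective
              (injective (ℕ.≤-pred (toℕ<n j)) (ℕ.≤-pred (toℕ<n i)) e)))))
            (trans (cong not (up j i j<i)) (trans (sym (signed-not sign (arcOf T′ j i)))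
              (cong (signed sign) (sym (arcOf-anti T′ (i≢j ∘ sym))))))

pullback : ∀ {m n} → Permutation m n → Tournament n → Tournament m
pullback π T = record { _⟶_ = λ x y → (π ⟨$⟩ʳ x) ⟶ (π ⟨$⟩ʳ y) ; compare = cmp }
  where
  open Tournament T
  cmp : ∀ x y → _
  cmp x y with compare (π ⟨$⟩ʳ x) (π ⟨$⟩ʳ y)
  ... | tri< xy x≢y ¬yx = tri< xy (x≢y ∘ cong (π ⟨$⟩ʳ_)) ¬yx
  ... | tri≈ ¬xy x≡y ¬yx = tri≈ ¬xy (trans (sym (inverseˡ π)) (trans (cong (π ⟨$⟩ˡ_) x≡y) (inverseˡ π))) ¬yx
  ... | tri> ¬xy x≢y yx = tri> ¬xy (x≢y ∘ cong (π ⟨$⟩ʳ_)) yx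

pullback-arc : ∀ {m n} (π : Permutation m n) T {x y} →
               arcOf (pullback π T) x y ≡ arcOf T (π ⟨$⟩ʳ x) (π ⟨$⟩ʳ y)
pullback-arc π T {x} {y} with Tournament.compare T (π ⟨$⟩ʳ x) (π ⟨$⟩ʳ y)
... | tri< _ _ _ = refl
... | tri≈ _ _ _ = refl
... | tri> _ _ _ = refl

-- The realization is `T` pulled back along the isomorphism; the pullback is isomorphic to `T` with
-- positive sign, so the `C₃`-structures correspond.
≅C₃⇒realizable : ∀ {m n} {H : Hypergraph m} (T : Tournament n) → H ≅ C₃ T → Realizable H
≅C₃⇒realizable T (π , iso) = pullback π T , λ e →
  let module F = Equivalence (iso e)
      module G = Equivalence (C₃-iso π true (pullback π T) T (λ _ → trans (pullback-arc π T) (signed-true _)) e)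
  in mk⇔ (G.from ∘ F.to) (F.from ∘ G.to)
  where
  signed-true : ∀ p → p ≡ signed true p
  signed-true true  = refl
  signed-true false = refl

labelling⇒≅C₃ : ∀ {v} {H : Hypergraph v} {T : Tournament v} → Realizes T H →
                Labels.Labelling (arcOf T) (arcOf-anti T) →
                ∃[ kind ] ∃[ m ] (1 ≤ m × v ≡ suc (2 * m) × H ≅ C₃ (tournament kind m))
labelling⇒≅C₃ {T = T} realizes L = kind , m , 1≤m , ↔⇒≡ π , π , λ e →
  let module F = Equivalence (realizes e)
      module G = Equivalence (C₃-iso π sign T (tournament kind m) (labelling-iso T L) e)
  in mk⇔ (G.to ∘ F.to) (F.from ∘ G.from)
  where
  open Labels.Labelling L using (kind; m; 1≤m; sign)
  π : Permutation _ (suc (2 * m))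
  π = labelling-permutation T L

realizable⇒≅C₃ : ∀ {v} {H : Hypergraph v} → Critical H → Realizable H →
                 ∃[ kind ] ∃[ m ] (1 ≤ m × v ≡ suc (2 * m) × H ≅ C₃ (tournament kind m))
realizable⇒≅C₃ {suc v} {H} ((_ , prime) , critical) (T , realizes) =
  labelling⇒≅C₃ {H = H} {T} realizes
    (labelling ¬NF crit (proj₂ (proj₂ (critical-edge T ¬NF crit zero))))
  where
  open Realization T
  open Labels (arcOf T) (arcOf-anti T)
  ¬NF : ¬ NontrivialModule Full
  ¬NF N with NontrivialModule⇒decomposable {H = H} {T} realizes N
  ... | M , isModule , nontrivial = nontrivial (prime M isModule)
  crit : ∀ x → NontrivialModule (Off x)
  crit x = decomposable⇒NontrivialModule {H = H} {T} realizes x (critical x)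

theorem53 : ∀ (v : ℕ) (H : Hypergraph v) → Critical H →
    Realizable H ⇔
      (∃[ n ] 1 ≤ n × v ≡ suc (2 * n) ×
        (H ≅ C₃ (T₂ₙ₊₁ n) ⊎ H ≅ C₃ (U₂ₙ₊₁ n) ⊎ H ≅ C₃ (W₂ₙ₊₁ n)))
theorem53 v H critical = mk⇔ forth back
  where
  Classified : Set
  Classified = ∃[ n ] 1 ≤ n × v ≡ suc (2 * n) ×
    (H ≅ C₃ (T₂ₙ₊₁ n) ⊎ H ≅ C₃ (U₂ₙ₊₁ n) ⊎ H ≅ C₃ (W₂ₙ₊₁ n))
  forth : Realizable H → Classified
  forth r with realizable⇒≅C₃ {H = H} critical r
  ... | kindT , m , 1≤m , v≡ , iso = m , 1≤m , v≡ , inj₁ iso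
  ... | kindU , m , 1≤m , v≡ , iso = m , 1≤m , v≡ , inj₂ (inj₁ iso)
  ... | kindW , m , 1≤m , v≡ , iso = m , 1≤m , v≡ , inj₂ (inj₂ iso)
  back : Classified → Realizable H
  back (m , _ , _ , inj₁ iso) = ≅C₃⇒realizable {H = H} (T₂ₙ₊₁ m) iso
  back (m , _ , _ , inj₂ (inj₁ iso)) = ≅C₃⇒realizable {H = H} (U₂ₙ₊₁ m) iso
  back (m , _ , _ , inj₂ (inj₂ iso)) = ≅C₃⇒realizable {H = H} (W₂ₙ₊₁ m) iso
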